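{- Let $b_1,b_2\ge1$. Let $G$ be the graph obtained from the star $\mathcal S_{1,b_1}$ and the spider $\mathcal S_{2,b_2}$ by identifying the center $v_1$ of $\mathcal S_{1,b_1}$ (degree $b_1$) with the center $v_2$ of $\mathcal S_{2,b_2}$ (degree $b_2$). Then $B(G)=\binom{b_1}{2}$.
   Context: For $a,b\ge1$, $\mathcal S_{a,b}$ denotes the tree consisting of $b$ paths, each with $a$ edges, sharing one common endpoint (the center); thus $\mathcal S_{1,b}$ is a star with $b$ leaves. For a connected graph $G$, $\kappa(G)$ is Kemeny's constant of the simple random walk on $G$: $\kappa(G)=\sum_{j\ne i}m_{ij}\pi_j$ ($m_{ij}$ mean first passage time, $\pi$ stationary distribution). A pair of nonadjacent vertices is a Braess edge of $G$ if adding the edge between them strictly increases $\kappa$; $B(G)$ is the number of Braess edges of $G$. -}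

module Defs where

open import Data.Bool using (Bool; true; false; _∧_; _∨_; if_then_else_)
open import Data.Nat as ℕ using (ℕ; zero; suc; _≡ᵇ_; _≤ᵇ_; _%_)
open import Data.Fin as Fin using (Fin; toℕ)
open import Data.Integer using (+_)
open import Data.Rational as ℚ using (ℚ; _/_; 0ℚ; 1ℚ)
open import Data.Product using (Σ; _×_; _,_)
open import Data.List using (List; length)
open import Data.List.Membership.Propositional using (_∈_)
open import Data.List.Relation.Unary.Unique.Propositional using (Unique)
open import Relation.Binary.PropositionalEquality using (_≡_; _≢_)
open import Function.Bundles using (_⇔_)

Graph : ℕ → Set
Graph n = Fin n → Fin n → Bool

Σℕ : ∀ {n} → (Fin n → ℕ) → ℕ
Σℕ {zero}  f = 0
Σℕ {suc n} f = f Fin.zero ℕ.+ Σℕ (λ i → f (Fin.suc i))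

Σℚ : ∀ {n} → (Fin n → ℚ) → ℚ
Σℚ {zero}  f = 0ℚ
Σℚ {suc n} f = f Fin.zero ℚ.+ Σℚ (λ i → f (Fin.suc i))

b2n : Bool → ℕ
b2n true = 1
b2n false = 0

deg : ∀ {n} → Graph n → Fin n → ℕ
deg A i = Σℕ (λ j → b2n (A i j))

P : ∀ {n} → Graph n → Fin n → Fin n → ℚ
P A i j with deg A i
... | zero  = 0ℚ
... | suc d = + b2n (A i j) / suc d

IsStationary : ∀ {n} → Graph n → (Fin n → ℚ) → Set
IsStationary A π =
  (∀ j → (0ℚ ℚ.≤ π j)) × (Σℚ π ≡ 1ℚ) × (∀ j → π j ≡ Σℚ (λ i → π i ℚ.* P A i j))

IsMFPT : ∀ {n} → Graph n → (Fin n → Fin n → ℚ) → Set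
IsMFPT A m = ∀ i j → i ≢ j →
  m i j ≡ 1ℚ ℚ.+ Σℚ (λ k → if toℕ k ≡ᵇ toℕ j then 0ℚ else P A i k ℚ.* m k j)

IsKemeny : ∀ {n} → Graph n → ℚ → Set
IsKemeny {n} A κ = Σ (Fin n → ℚ) λ π → Σ (Fin n → Fin n → ℚ) λ m →
  IsStationary A π × IsMFPT A m ×
  (∀ i → κ ≡ Σℚ (λ j → if toℕ j ≡ᵇ toℕ i then 0ℚ else m i j ℚ.* π j))

addEdge : ∀ {n} → Graph n → Fin n → Fin n → Graph n
addEdge A u v x y =
  A x y ∨ ((toℕ x ≡ᵇ toℕ u) ∧ (toℕ y ≡ᵇ toℕ v)) ∨ ((toℕ x ≡ᵇ toℕ v) ∧ (toℕ y ≡ᵇ toℕ u))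

IsBraess : ∀ {n} → Graph n → Fin n → Fin n → Set
IsBraess A u v = u ≢ v × A u v ≡ false ×
  Σ ℚ λ κ → Σ ℚ λ κ' → IsKemeny A κ × IsKemeny (addEdge A u v) κ' × κ ℚ.< κ'

-- B(A) = k : there is a duplicate-free list of exactly k pairs u < v which are
-- precisely the Braess edges (each unordered pair listed once as u < v).
HasBraessNumber : ∀ {n} → Graph n → ℕ → Set
HasBraessNumber {n} A k = Σ (List (Fin n × Fin n)) λ L →
  Unique L × length L ≡ k ×
  (∀ u v → ((u , v) ∈ L) ⇔ ((u Fin.< v) × IsBraess A u v))

-- The graph G of the theorem, on vertices 0 .. b1 + 2 b2 (labels via toℕ):
--   0            : common center v1 = v2
--   1 .. b1      : leaves of the star S_{1,b1}
--   b1+1+2i      : middle vertex of the i-th leg of S_{2,b2}  (0 ≤ i < b2)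
--   b1+2+2i      : end vertex of the i-th leg
order : ℕ → ℕ → ℕ
order b1 b2 = suc (b1 ℕ.+ 2 ℕ.* b2)

isMid : ℕ → ℕ → Bool
isMid b1 x = (suc b1 ≤ᵇ x) ∧ ((x ℕ.∸ suc b1) % 2 ≡ᵇ 0)

adjLt : ℕ → ℕ → ℕ → Bool
adjLt b1 x y =
  ((x ≡ᵇ 0) ∧ (1 ≤ᵇ y) ∧ (y ≤ᵇ b1)) ∨
  ((x ≡ᵇ 0) ∧ isMid b1 y) ∨
  (isMid b1 x ∧ (y ≡ᵇ suc x))

starSpider : (b1 b2 : ℕ) → Graph (order b1 b2)
starSpider b1 b2 x y = adjLt b1 (toℕ x) (toℕ y) ∨ adjLt b1 (toℕ y) (toℕ x)

{-# OPTIONS --safe #-}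
-- Let L be the Laplacian and d the degree vector of a connected graph, D = Σ d, and let G be a
-- symmetric matrix with L G = I - e_c 1ᵀ (a Green matrix rooted at a vertex c).  Inverting L with G
-- shows that the mean first passage times must be
--   m i j = (G d) i - (G d) j + D (G j j - G i j)
-- and π = d / D, hence D κ = D Σⱼ d j G j j - dᵀ G d.  Adding an edge u v replaces G by the rank-one
-- update G - g gᵀ / (1 + r) with g = G (e_u - e_v) and r = g u - g v, so D (D + 2) times the change of
-- κ only involves G, G d and G diag(d) G at u and v.  For the star-spider rooted at its centre these
-- entries are small constants depending on the kinds of u and v.  The change is then a quadratic
-- polynomial in b1 and b2, and its Taylor coefficients at the smallest admissible (b1 , b2) are all
-- of one sign: positive for two leaves of the star and negative for every other nonadjacent pair.
module Submission where

open import Defs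
open import Data.Nat using (ℕ; _≤_)
open import Data.Nat.Combinatorics using (_C_)
open import Data.Bool using (Bool; true; false; if_then_else_; _∧_; _∨_)
open import Data.Bool.Properties using (∧-comm; ∨-comm; ∨-identityʳ)
open import Data.Empty using (⊥)
open import Data.Fin as Fin using (Fin; toℕ; _↑ˡ_; _↑ʳ_; splitAt; combine; remQuot)
open import Data.Fin.Patterns using (0F; 1F)
import Data.Fin.Properties as Finₚ
import Data.Integer as ℤ
import Data.Integer.Properties as ℤₚ
open import Data.List using (List; []; _++_; map; length; allFin)
open import Data.List.Membership.Propositional using (_∈_)
open import Data.List.Membership.Propositional.Properties using (∈-map⁺; ∈-map⁻; ∈-++⁺ˡ; ∈-++⁺ʳ; ∈-++⁻; ∈-allFin)
open import Data.List.Properties using (length-map; length-++; length-tabulate)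
open import Data.List.Relation.Unary.Unique.Propositional using (Unique; [])
import Data.List.Relation.Unary.Unique.Propositional.Properties as Uniqueₚ
open import Data.Nat as ℕ using (zero; suc; _≡ᵇ_; _≤ᵇ_; _%_)
open import Data.Nat.Combinatorics using (nC1≡n; nCk+nC[k+1]≡[n+1]C[k+1])
open import Data.Nat.DivMod using ([m+kn]%n≡m%n)
import Data.Nat.Properties as ℕₚ
open import Data.Product using (Σ; _×_; _,_; ∃₂; proj₁; proj₂; uncurry) renaming (map to map×)
open import Data.Rational as ℚ using (ℚ; _/_; 0ℚ; 1ℚ; _+_; _*_; _-_; -_; toℚᵘ; Positive; NonNegative)
import Data.Rational.Properties as ℚₚ
open import Data.Rational.Unnormalised as ℚᵘ using (mkℚᵘ; *≡*)
import Data.Rational.Unnormalised.Properties as ℚᵘₚ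
open import Data.Sum using (inj₁; inj₂; [_,_]′)
open import Function using (case_of_; _∘_)
open import Function.Bundles using (mk⇔)
open import Relation.Binary.PropositionalEquality
open import Relation.Nullary using (does; yes; no; contradiction; ¬_)
open import Relation.Nullary.Decidable using (dec-true; dec-false)
open import Relation.Nullary.Decidable.Core using (dec⇒maybe)
open import Tactic.RingSolver using (solve-∀)
open import Tactic.RingSolver.Core.AlmostCommutativeRing using (AlmostCommutativeRing; fromCommutativeRing)

-- Finite sums of rationals

-- `IsBraess` asserts the existence of both values of Kemeny's constant, so the counted pairs need a
-- construction of such values, while the rejected pairs need that any value whatever equals the
-- computed one. Connectedness is never phrased with paths: the Green matrix carries it, because
-- `green-representation` makes harmonic functions constant. The closed form behind the calculation
-- is κ = dᵀ R d / (2 D), with R the matrix of effective resistances. Rooting G at the centre is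
-- what keeps the entries constant. The row of the centre vanishes, so its degree b1 + b2, the only
-- unbounded one, enters neither G d nor G diag(d) G. The paths from the centre to two nonadjacent
-- vertices share no edge, so all mixed entries vanish as well. Hence b1 and b2 survive only in the
-- volume 2 b1 + 4 b2 and the energy b1 + 10 b2. The leading coefficient of the change is governed
-- by the increment τ of the trace. It is 2/3 for two leaves of the star, but it is 0 for leaf and
-- middle, leaf and end, and two ends; for these kinds the linear part has to decide.

ringℚ : AlmostCommutativeRing _ _
ringℚ = fromCommutativeRing ℚₚ.+-*-commutativeRing (λ x → dec⇒maybe (0ℚ ℚₚ.≟ x))

-- Recursion instead of a fraction lets sums over `Fin n` reduce by induction and closed values
-- evaluate; `ι*/` is the bridge to the quotients in `P`.
ι : ℕ → ℚ
ι zero    = 0ℚ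
ι (suc n) = 1ℚ + ι n

ι-+ : ∀ m n → ι (m ℕ.+ n) ≡ ι m + ι n
ι-+ zero    n = sym (ℚₚ.+-identityˡ (ι n))
ι-+ (suc m) n = trans (cong (1ℚ +_) (ι-+ m n)) (sym (ℚₚ.+-assoc 1ℚ (ι m) (ι n)))

ι-≥0 : ∀ n → 0ℚ ℚ.≤ ι n
ι-≥0 zero    = ℚₚ.≤-refl
ι-≥0 (suc n) = ℚₚ.+-mono-≤ (ℚₚ.nonNegative⁻¹ 1ℚ) (ι-≥0 n)

ι>0 : ∀ {n} → 1 ℕ.≤ n → 0ℚ ℚ.< ι n
ι>0 {suc n} _ = ℚₚ.+-mono-<-≤ (ℚₚ.positive⁻¹ 1ℚ) (ι-≥0 n)

toℚᵘ-ι : ∀ n → toℚᵘ (ι n) ℚᵘ.≃ mkℚᵘ (ℤ.+ n) 0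
toℚᵘ-ι zero    = ℚᵘₚ.≃-refl
toℚᵘ-ι (suc n) = begin
  toℚᵘ (1ℚ + ι n)                  ≈⟨ ℚₚ.toℚᵘ-homo-+ 1ℚ (ι n) ⟩
  ℚᵘ.1ℚᵘ ℚᵘ.+ toℚᵘ (ι n)           ≈⟨ ℚᵘₚ.+-congʳ ℚᵘ.1ℚᵘ (toℚᵘ-ι n) ⟩
  ℚᵘ.1ℚᵘ ℚᵘ.+ mkℚᵘ (ℤ.+ n) 0       ≈⟨ *≡* (cong (λ t → (ℤ.+ 1 ℤ.+ t) ℤ.* ℤ.+ 1) (ℤₚ.*-identityʳ (ℤ.+ n))) ⟩
  mkℚᵘ (ℤ.+ suc n) 0               ∎
  where open ℚᵘₚ.≃-Reasoning

ι*/ : ∀ m d → ι (suc d) * (ℤ.+ m / suc d) ≡ ι m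
-- `_/_` reduces to lowest terms, which blocks computation for variable `m` and `d`; among
-- unnormalised rationals the equation is a cross-multiplication.
ι*/ m d = ℚₚ.toℚᵘ-injective (begin
  toℚᵘ (ι (suc d) * (ℤ.+ m / suc d))         ≈⟨ ℚₚ.toℚᵘ-homo-* (ι (suc d)) (ℤ.+ m / suc d) ⟩
  toℚᵘ (ι (suc d)) ℚᵘ.* toℚᵘ (ℤ.+ m / suc d) ≈⟨ ℚᵘₚ.*-cong (toℚᵘ-ι (suc d)) (ℚₚ.toℚᵘ-fromℚᵘ (mkℚᵘ (ℤ.+ m) d)) ⟩
  mkℚᵘ (ℤ.+ suc d) 0 ℚᵘ.* mkℚᵘ (ℤ.+ m) d       ≈⟨ *≡* (trans (ℤₚ.*-identityʳ _) (trans (ℤₚ.*-comm (ℤ.+ suc d) (ℤ.+ m)) (cong (ℤ.+ m ℤ.*_) (sym (ℤₚ.*-identityˡ (ℤ.+ suc d)))))) ⟩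
  mkℚᵘ (ℤ.+ m) 0                             ≈⟨ toℚᵘ-ι m ⟨
  toℚᵘ (ι m)                               ∎)
  where open ℚᵘₚ.≃-Reasoning

x-y≡0⇒x≡y : ∀ {x y} → x - y ≡ 0ℚ → x ≡ y
x-y≡0⇒x≡y {x} {y} x-y≡0 = trans (split x y) (trans (cong (_+ y) x-y≡0) (ℚₚ.+-identityˡ y))
  where
  split : ∀ x y → x ≡ (x - y) + y
  split = solve-∀ ringℚ

*-cancelˡ-≡-pos : ∀ {r x y} → 0ℚ ℚ.< r → r * x ≡ r * y → x ≡ y
*-cancelˡ-≡-pos {r} r>0 rx≡ry = ℚₚ.≤-antisym
  (ℚₚ.*-cancelˡ-≤-pos r (ℚₚ.≤-reflexive rx≡ry))
  (ℚₚ.*-cancelˡ-≤-pos r (ℚₚ.≤-reflexive (sym rx≡ry)))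
  where instance _ = ℚ.positive r>0

δ : ∀ {n} → Fin n → Fin n → ℚ
δ i j = if does (i Fin.≟ j) then 1ℚ else 0ℚ

δ-refl : ∀ {n} (i : Fin n) → δ i i ≡ 1ℚ
δ-refl i = cong (if_then 1ℚ else 0ℚ) (dec-true (i Fin.≟ i) refl)

δ-≢ : ∀ {n} {i j : Fin n} → i ≢ j → δ i j ≡ 0ℚ
δ-≢ {i = i} {j} i≢j = cong (if_then 1ℚ else 0ℚ) (dec-false (i Fin.≟ j) i≢j)

δ-sym : ∀ {n} (i j : Fin n) → δ i j ≡ δ j i
δ-sym i j with i Fin.≟ j
... | yes refl = sym (δ-refl i)
... | no i≢j   = sym (δ-≢ (≢-sym i≢j))

δ-subst : ∀ {n} (i j : Fin n) (f : Fin n → ℚ) → δ i j * f i ≡ δ i j * f j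
δ-subst i j f with i Fin.≟ j
... | yes refl = refl
... | no _     = trans (ℚₚ.*-zeroˡ (f i)) (sym (ℚₚ.*-zeroˡ (f j)))

toℕ-≡ᵇ : ∀ {n} (i j : Fin n) → (toℕ i ℕ.≡ᵇ toℕ j) ≡ does (i Fin.≟ j)
toℕ-≡ᵇ Fin.zero    Fin.zero    = refl
toℕ-≡ᵇ Fin.zero    (Fin.suc j) = refl
toℕ-≡ᵇ (Fin.suc i) Fin.zero    = refl
toℕ-≡ᵇ (Fin.suc i) (Fin.suc j) = toℕ-≡ᵇ i j

Σ-cong : ∀ {n} {f g : Fin n → ℚ} → (∀ i → f i ≡ g i) → Σℚ f ≡ Σℚ g
Σ-cong {zero}  f≗g = refl
Σ-cong {suc n} f≗g = cong₂ _+_ (f≗g Fin.zero) (Σ-cong (λ i → f≗g (Fin.suc i)))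

Σ-+ : ∀ {n} (f g : Fin n → ℚ) → Σℚ (λ i → f i + g i) ≡ Σℚ f + Σℚ g
Σ-+ {zero}  f g = refl
Σ-+ {suc n} f g = trans (cong ((f Fin.zero + g Fin.zero) +_) (Σ-+ (λ i → f (Fin.suc i)) (λ i → g (Fin.suc i))))
                        (interchange (f Fin.zero) (g Fin.zero) _ _)
  where
  interchange : ∀ a b x y → a + b + (x + y) ≡ a + x + (b + y)
  interchange = solve-∀ ringℚ

Σ-*ˡ : ∀ {n} c (f : Fin n → ℚ) → Σℚ (λ i → c * f i) ≡ c * Σℚ f
Σ-*ˡ {zero}  c f = sym (ℚₚ.*-zeroʳ c)
Σ-*ˡ {suc n} c f = trans (cong (c * f Fin.zero +_) (Σ-*ˡ c (λ i → f (Fin.suc i))))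
                         (sym (ℚₚ.*-distribˡ-+ c (f Fin.zero) _))

Σ-*ʳ : ∀ {n} c (f : Fin n → ℚ) → Σℚ (λ i → f i * c) ≡ Σℚ f * c
Σ-*ʳ c f = trans (Σ-cong (λ i → ℚₚ.*-comm (f i) c)) (trans (Σ-*ˡ c f) (ℚₚ.*-comm c (Σℚ f)))

Σ-neg : ∀ {n} (f : Fin n → ℚ) → Σℚ (λ i → - f i) ≡ - Σℚ f
Σ-neg {zero}  f = refl
Σ-neg {suc n} f = trans (cong (- f Fin.zero +_) (Σ-neg (λ i → f (Fin.suc i))))
                        (sym (ℚₚ.neg-distrib-+ (f Fin.zero) _))

Σ-minus : ∀ {n} (f g : Fin n → ℚ) → Σℚ (λ i → f i - g i) ≡ Σℚ f - Σℚ g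
Σ-minus f g = trans (Σ-+ f (λ i → - g i)) (cong (Σℚ f +_) (Σ-neg g))

Σ-const : ∀ n c → Σℚ {n} (λ _ → c) ≡ ι n * c
Σ-const zero    c = sym (ℚₚ.*-zeroˡ c)
Σ-const (suc n) c = trans (cong (_+_ c) (Σ-const n c)) (collect c (ι n))
  where
  collect : ∀ c x → c + x * c ≡ (1ℚ + x) * c
  collect = solve-∀ ringℚ

Σ-0 : ∀ n → Σℚ {n} (λ _ → 0ℚ) ≡ 0ℚ
Σ-0 n = trans (Σ-const n 0ℚ) (ℚₚ.*-zeroʳ (ι n))

Σ-swap : ∀ {m n} (f : Fin m → Fin n → ℚ) → Σℚ (λ i → Σℚ (f i)) ≡ Σℚ (λ j → Σℚ (λ i → f i j))
Σ-swap {zero} {n} f = sym (Σ-0 n)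
Σ-swap {suc m} f = trans (cong (Σℚ (f Fin.zero) +_) (Σ-swap (λ i → f (Fin.suc i))))
                         (sym (Σ-+ (f Fin.zero) (λ j → Σℚ (λ i → f (Fin.suc i) j))))

Σ-δ : ∀ {n} (j : Fin n) (f : Fin n → ℚ) → Σℚ (λ i → δ i j * f i) ≡ f j
Σ-δ {suc n} Fin.zero f = trans (cong₂ _+_ (ℚₚ.*-identityˡ (f Fin.zero))
                                     (trans (Σ-cong (λ i → ℚₚ.*-zeroˡ (f (Fin.suc i)))) (Σ-0 n)))
                          (ℚₚ.+-identityʳ (f Fin.zero))
Σ-δ (Fin.suc j) f = trans (cong₂ _+_ (ℚₚ.*-zeroˡ (f Fin.zero)) (Σ-δ j (λ i → f (Fin.suc i))))
                          (ℚₚ.+-identityˡ (f (Fin.suc j)))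

Σ-pos : ∀ {n} {f : Fin n → ℚ} → Fin n → (∀ i → 0ℚ ℚ.< f i) → 0ℚ ℚ.< Σℚ f
Σ-pos {suc zero}    {f} _ f>0 = subst (0ℚ ℚ.<_) (sym (ℚₚ.+-identityʳ (f Fin.zero))) (f>0 Fin.zero)
Σ-pos {suc (suc n)} {f} _ f>0 =
  ℚₚ.+-mono-< (f>0 Fin.zero) (Σ-pos {f = λ i → f (Fin.suc i)} Fin.zero (λ i → f>0 (Fin.suc i)))

ι-Σ : ∀ {n} (f : Fin n → ℕ) → ι (Σℕ f) ≡ Σℚ (λ i → ι (f i))
ι-Σ {zero}  f = refl
ι-Σ {suc n} f = trans (ι-+ (f Fin.zero) _) (cong (_+_ (ι (f Fin.zero))) (ι-Σ (λ i → f (Fin.suc i))))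

Σ-δ≡1 : ∀ {n} (j : Fin n) → Σℚ (δ j) ≡ 1ℚ
Σ-δ≡1 j = trans (Σ-cong (λ i → trans (δ-sym j i) (sym (ℚₚ.*-identityʳ (δ i j))))) (Σ-δ j (λ _ → 1ℚ))

Σ-↑ : ∀ m {n} (f : Fin (m ℕ.+ n) → ℚ) → Σℚ f ≡ Σℚ (λ i → f (i ↑ˡ n)) + Σℚ (λ j → f (m ↑ʳ j))
Σ-↑ zero    f = sym (ℚₚ.+-identityˡ (Σℚ f))
Σ-↑ (suc m) f = trans (cong (f Fin.zero +_) (Σ-↑ m (f ∘ Fin.suc))) (sym (ℚₚ.+-assoc (f Fin.zero) _ _))

Σ-combine₂ : ∀ n (f : Fin (n ℕ.* 2) → ℚ) → Σℚ f ≡ Σℚ {n} (λ i → f (combine i 0F) + f (combine i 1F))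
Σ-combine₂ zero    f = refl
Σ-combine₂ (suc n) f =
  trans (sym (ℚₚ.+-assoc (f 0F) (f 1F) _)) (cong ((f 0F + f 1F) +_) (Σ-combine₂ n (λ i → f (Fin.suc (Fin.suc i)))))

Σ-cast : ∀ {m n} (eq : m ≡ n) (f : Fin n → ℚ) → Σℚ f ≡ Σℚ (λ i → f (Fin.cast eq i))
Σ-cast refl f = Σ-cong (λ i → cong f (sym (Finₚ.cast-is-id refl i)))

Σ-0* : ∀ {n} (f : Fin n → ℚ) → Σℚ (λ i → 0ℚ * f i) ≡ 0ℚ
Σ-0* f = trans (Σ-*ˡ 0ℚ f) (ℚₚ.*-zeroˡ (Σℚ f))

δ-injective : ∀ {m n} {h : Fin m → Fin n} → (∀ {i j} → h i ≡ h j → i ≡ j) → ∀ i j → δ (h i) (h j) ≡ δ i j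
δ-injective {h = h} inj i j = case i Fin.≟ j of λ where
  (yes refl) → trans (δ-refl (h i)) (sym (δ-refl i))
  (no i≢j)   → trans (δ-≢ (i≢j ∘ inj)) (sym (δ-≢ i≢j))

ι-b2n : ∀ b → ι (b2n b) ≡ (if b then 1ℚ else 0ℚ)
ι-b2n true  = refl
ι-b2n false = refl

-- Kemeny's constant from a Green matrix

open ≡-Reasoning

module _ {n : ℕ} (A : Graph n) where

  weight : Fin n → Fin n → ℚ
  weight i j = ι (b2n (A i j))

  degree : Fin n → ℚ
  degree i = Σℚ (weight i)

  volume : ℚ
  volume = Σℚ degree

  laplacian : (Fin n → ℚ) → Fin n → ℚ
  laplacian f i = degree i * f i - Σℚ (λ k → weight i k * f k)

  -- With symmetric weights every image of the Laplacian sums to 0, so the identity matrix is out of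
  -- reach; a unit sink at `c` balances each column. `LG≡δ` is also where connectedness is encoded.
  record IsGreen (c : Fin n) (G : Fin n → Fin n → ℚ) : Set where
    field
      A-sym    : ∀ i j → A i j ≡ A j i
      degree>0 : ∀ i → 0ℚ ℚ.< degree i
      G-sym    : ∀ i j → G i j ≡ G j i
      LG≡δ     : ∀ j i → laplacian (λ k → G k j) i ≡ δ i j - δ i c

  potential : (Fin n → Fin n → ℚ) → Fin n → ℚ
  potential G i = Σℚ (λ k → G i k * degree k)

  trace : (Fin n → Fin n → ℚ) → ℚ
  trace G = Σℚ (λ j → degree j * G j j)

  energy : (Fin n → Fin n → ℚ) → ℚ
  energy G = Σℚ (λ j → degree j * potential G j)

  -- Clears the denominator of `P`. At an isolated vertex both sides are 0, since a vanishing sum of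
  -- naturals has vanishing terms; otherwise the degree is `ι (suc d)` and `ι*/` applies.
  degree*P : ∀ i j → degree i * P A i j ≡ weight i j
  degree*P i j with deg A i | ι-Σ (λ k → b2n (A i k)) | Σ-entry i j
    where
    Σℕ≡0 : ∀ {m} (f : Fin m → ℕ) → Σℕ f ≡ 0 → ∀ k → f k ≡ 0
    Σℕ≡0 {suc m} f eq Fin.zero with f Fin.zero
    ... | zero = refl
    Σℕ≡0 {suc m} f eq (Fin.suc k) with f Fin.zero
    ... | zero = Σℕ≡0 (λ x → f (Fin.suc x)) eq k
    Σ-entry : ∀ i j → deg A i ≡ 0 → b2n (A i j) ≡ 0
    Σ-entry i j eq = Σℕ≡0 (λ k → b2n (A i k)) eq j
  ... | zero  | _  | a≡0 = trans (ℚₚ.*-zeroʳ (degree i)) (sym (cong ι (a≡0 refl)))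
  ... | suc d | eq | _   = trans (cong (_* _) (sym eq)) (ι*/ (b2n (A i j)) d)

  laplacian-linear : ∀ x f y g i → laplacian (λ k → x * f k + y * g k) i ≡ x * laplacian f i + y * laplacian g i
  laplacian-linear x f y g i = begin
    degree i * (x * f i + y * g i) - Σℚ (λ k → weight i k * (x * f k + y * g k))
      ≡⟨ cong (λ t → degree i * (x * f i + y * g i) - t) split ⟩
    degree i * (x * f i + y * g i) - (x * Σℚ (λ k → weight i k * f k) + y * Σℚ (λ k → weight i k * g k))
      ≡⟨ regroup (degree i) x (f i) y (g i) _ _ ⟩
    x * laplacian f i + y * laplacian g i ∎
    where
    expand : ∀ w x p y q → w * (x * p + y * q) ≡ x * (w * p) + y * (w * q)
    expand = solve-∀ ringℚ
    regroup : ∀ d x p y q a b → d * (x * p + y * q) - (x * a + y * b) ≡ x * (d * p - a) + y * (d * q - b)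
    regroup = solve-∀ ringℚ
    split : Σℚ (λ k → weight i k * (x * f k + y * g k))
          ≡ x * Σℚ (λ k → weight i k * f k) + y * Σℚ (λ k → weight i k * g k)
    split = begin
      Σℚ (λ k → weight i k * (x * f k + y * g k))
        ≡⟨ Σ-cong (λ k → expand (weight i k) x (f k) y (g k)) ⟩
      Σℚ (λ k → x * (weight i k * f k) + y * (weight i k * g k))
        ≡⟨ Σ-+ (λ k → x * (weight i k * f k)) (λ k → y * (weight i k * g k)) ⟩
      Σℚ (λ k → x * (weight i k * f k)) + Σℚ (λ k → y * (weight i k * g k))
        ≡⟨ cong₂ _+_ (Σ-*ˡ x (λ k → weight i k * f k)) (Σ-*ˡ y (λ k → weight i k * g k)) ⟩
      x * Σℚ (λ k → weight i k * f k) + y * Σℚ (λ k → weight i k * g k) ∎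

  laplacian-const : ∀ x i → laplacian (λ _ → x) i ≡ 0ℚ
  laplacian-const x i = trans (cong (λ t → degree i * x - t) (Σ-*ʳ x (weight i))) (ℚₚ.+-inverseʳ (degree i * x))

  laplacian-Σ : ∀ {m} (F : Fin m → Fin n → ℚ) (x : Fin m → ℚ) i →
                laplacian (λ k → Σℚ (λ l → F l k * x l)) i ≡ Σℚ (λ l → laplacian (F l) i * x l)
  laplacian-Σ {zero}  F x i = laplacian-const 0ℚ i
  laplacian-Σ {suc m} F x i = begin
    laplacian (λ k → F Fin.zero k * x Fin.zero + tail k) i
      ≡⟨ cong₂ (λ s t → degree i * s - t) (arrange i) (Σ-cong (λ k → cong (weight i k *_) (arrange k))) ⟩
    laplacian (λ k → x Fin.zero * F Fin.zero k + 1ℚ * tail k) i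
      ≡⟨ laplacian-linear (x Fin.zero) (F Fin.zero) 1ℚ tail i ⟩
    x Fin.zero * laplacian (F Fin.zero) i + 1ℚ * laplacian tail i
      ≡⟨ cong₂ _+_ (ℚₚ.*-comm (x Fin.zero) (laplacian (F Fin.zero) i)) (trans (ℚₚ.*-identityˡ (laplacian tail i)) (laplacian-Σ (λ l → F (Fin.suc l)) (λ l → x (Fin.suc l)) i)) ⟩
    Σℚ (λ l → laplacian (F l) i * x l) ∎
    where
    tail : Fin n → ℚ
    tail k = Σℚ (λ l → F (Fin.suc l) k * x (Fin.suc l))
    arrange : ∀ k → F Fin.zero k * x Fin.zero + tail k ≡ x Fin.zero * F Fin.zero k + 1ℚ * tail k
    arrange k = cong₂ _+_ (ℚₚ.*-comm (F Fin.zero k) (x Fin.zero)) (sym (ℚₚ.*-identityˡ (tail k)))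

  laplacian-cong : ∀ {f g} → (∀ k → f k ≡ g k) → ∀ i → laplacian f i ≡ laplacian g i
  laplacian-cong f≗g i = cong₂ (λ s t → degree i * s - t) (f≗g i) (Σ-cong (λ k → cong (weight i k *_) (f≗g k)))

  laplacian-selfAdjoint : (∀ i j → A i j ≡ A j i) → ∀ f g →
                          Σℚ (λ i → f i * laplacian g i) ≡ Σℚ (λ i → laplacian f i * g i)
  laplacian-selfAdjoint A-sym f g = begin
    Σℚ (λ i → f i * laplacian g i)
      ≡⟨ Σ-cong (λ i → trans (expandˡ (f i) (degree i) (g i) (Σℚ (λ k → weight i k * g k)))
                             (cong (λ t → degree i * f i * g i - t) (sym (Σ-*ˡ (f i) (λ k → weight i k * g k))))) ⟩
    Σℚ (λ i → degree i * f i * g i - Σℚ (fag i))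
      ≡⟨ Σ-minus (λ i → degree i * f i * g i) (λ i → Σℚ (fag i)) ⟩
    Σℚ (λ i → degree i * f i * g i) - Σℚ (λ i → Σℚ (fag i))
      ≡⟨ cong (λ t → Σℚ (λ i → degree i * f i * g i) - t) (trans (Σ-swap fag) (Σ-cong (λ k → Σ-cong (λ i → flip i k)))) ⟩
    Σℚ (λ i → degree i * f i * g i) - Σℚ (λ i → Σℚ (afg i))
      ≡⟨ Σ-minus (λ i → degree i * f i * g i) (λ i → Σℚ (afg i)) ⟨
    Σℚ (λ i → degree i * f i * g i - Σℚ (afg i))
      ≡⟨ Σ-cong (λ i → trans (cong (λ t → degree i * f i * g i - t) (Σ-*ʳ (g i) (λ k → weight i k * f k)))
                             (collectʳ (f i) (degree i) (g i) (Σℚ (λ k → weight i k * f k)))) ⟩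
    Σℚ (λ i → laplacian f i * g i) ∎
    where
    fag afg : Fin n → Fin n → ℚ
    fag i k = f i * (weight i k * g k)
    afg i k = weight i k * f k * g i
    expandˡ : ∀ p d q a → p * (d * q - a) ≡ d * p * q - p * a
    expandˡ = solve-∀ ringℚ
    collectʳ : ∀ p d q a → d * p * q - a * q ≡ (d * p - a) * q
    collectʳ = solve-∀ ringℚ
    rotate : ∀ p w q → p * (w * q) ≡ w * p * q
    rotate = solve-∀ ringℚ
    flip : ∀ i k → fag i k ≡ afg k i
    flip i k = trans (rotate (f i) (weight i k) (g k)) (cong (λ e → ι (b2n e) * f i * g k) (A-sym i k))

-- `IsMFPT` leaves the diagonal of `m` free and skips the term k = j. Setting the diagonal to 0
-- turns the guarded sum into a full one, so that first-step equations become Laplacian equations.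
offDiagonal : ∀ {n} → (Fin n → Fin n → ℚ) → Fin n → Fin n → ℚ
offDiagonal m i j = if does (i Fin.≟ j) then 0ℚ else m i j

offDiagonal-refl : ∀ {n} (m : Fin n → Fin n → ℚ) i → offDiagonal m i i ≡ 0ℚ
offDiagonal-refl m i with i Fin.≟ i
... | yes _  = refl
... | no i≢i = contradiction refl i≢i

offDiagonal-≢ : ∀ {n} (m : Fin n → Fin n → ℚ) {i j} → i ≢ j → offDiagonal m i j ≡ m i j
offDiagonal-≢ m {i} {j} i≢j with i Fin.≟ j
... | yes i≡j = contradiction i≡j i≢j
... | no _    = refl

guard-*ˡ : ∀ {n} (m : Fin n → Fin n → ℚ) x k j →
           (if toℕ k ℕ.≡ᵇ toℕ j then 0ℚ else x * m k j) ≡ x * offDiagonal m k j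
guard-*ˡ m x k j rewrite toℕ-≡ᵇ k j with does (k Fin.≟ j)
... | true  = sym (ℚₚ.*-zeroʳ x)
... | false = refl

guard-*ʳ : ∀ {n} (m : Fin n → Fin n → ℚ) x i j →
           (if toℕ j ℕ.≡ᵇ toℕ i then 0ℚ else m i j * x) ≡ offDiagonal m i j * x
guard-*ʳ m x i j rewrite toℕ-≡ᵇ j i with i Fin.≟ j | j Fin.≟ i
... | yes _   | yes _   = sym (ℚₚ.*-zeroˡ x)
... | no _    | no _    = refl
... | yes i≡j | no j≢i  = contradiction (sym i≡j) j≢i
... | no i≢j  | yes j≡i = contradiction (sym j≡i) i≢j

module Kemeny {n} {A : Graph n} {c : Fin n} {G : Fin n → Fin n → ℚ} (green : IsGreen A c G) where
  open IsGreen green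

  private
    d = degree A
    D = volume A
    L = laplacian A
    s = potential A G

  volume>0 : 0ℚ ℚ.< D
  volume>0 = Σ-pos c degree>0

  -- In terms of effective resistances R this is Tetali's formula: half the sum over k of d k (R i j
  -- + R j k - R i k), where R i j = G i i + G j j - 2 G i j.
  hitting : Fin n → Fin n → ℚ
  hitting i j = s i - s j + D * (G j j - G i j)

  hitting-refl : ∀ j → hitting j j ≡ 0ℚ
  hitting-refl j = vanish (s j) D (G j j)
    where
    vanish : ∀ s D g → s - s + D * (g - g) ≡ 0ℚ
    vanish = solve-∀ ringℚ

  L-potential : ∀ i → L s i ≡ d i - δ i c * D
  L-potential i = begin
    L s i
      ≡⟨ laplacian-Σ A (λ l k → G k l) d i ⟩
    Σℚ (λ l → L (λ k → G k l) i * d l)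
      ≡⟨ Σ-cong (λ l → trans (cong (_* d l) (LG≡δ l i)) (trans (expand (δ i l) (δ i c) (d l)) (cong (λ t → t * d l - δ i c * d l) (δ-sym i l)))) ⟩
    Σℚ (λ l → δ l i * d l - δ i c * d l)
      ≡⟨ Σ-minus (λ l → δ l i * d l) (λ l → δ i c * d l) ⟩
    Σℚ (λ l → δ l i * d l) - Σℚ (λ l → δ i c * d l)
      ≡⟨ cong₂ _-_ (Σ-δ i d) (Σ-*ˡ (δ i c) d) ⟩
    d i - δ i c * D ∎
    where
    expand : ∀ a b x → (a - b) * x ≡ a * x - b * x
    expand = solve-∀ ringℚ

  L-hitting : ∀ j i → L (λ k → hitting k j) i ≡ d i - δ i j * D
  L-hitting j i = begin
    L (λ k → hitting k j) i
      ≡⟨ laplacian-cong A (λ k → arrange₁ (s k) (s j) D (G j j) (G k j)) i ⟩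
    L (λ k → 1ℚ * s k + 1ℚ * ((- D) * G k j + 1ℚ * (D * G j j - s j))) i
      ≡⟨ laplacian-linear A 1ℚ s 1ℚ (λ k → (- D) * G k j + 1ℚ * (D * G j j - s j)) i ⟩
    1ℚ * L s i + 1ℚ * L (λ k → (- D) * G k j + 1ℚ * (D * G j j - s j)) i
      ≡⟨ cong₂ (λ x y → 1ℚ * x + 1ℚ * y) (L-potential i)
           (trans (laplacian-linear A (- D) (λ k → G k j) 1ℚ (λ _ → D * G j j - s j) i)
                  (cong₂ (λ x y → (- D) * x + 1ℚ * y) (LG≡δ j i) (laplacian-const A (D * G j j - s j) i))) ⟩
    1ℚ * (d i - δ i c * D) + 1ℚ * ((- D) * (δ i j - δ i c) + 1ℚ * 0ℚ)
      ≡⟨ arrange₂ (d i) (δ i c) D (δ i j) ⟩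
    d i - δ i j * D ∎
    where
    arrange₁ : ∀ a b D g h → a - b + D * (g - h) ≡ 1ℚ * a + 1ℚ * ((- D) * h + 1ℚ * (D * g - b))
    arrange₁ = solve-∀ ringℚ
    arrange₂ : ∀ a x D y → 1ℚ * (a - x * D) + 1ℚ * ((- D) * (y - x) + 1ℚ * 0ℚ) ≡ a - y * D
    arrange₂ = solve-∀ ringℚ

  -- Self-adjointness against the constant function 1, which the Laplacian annihilates.
  ΣL≡0 : ∀ f → Σℚ (L f) ≡ 0ℚ
  ΣL≡0 f = begin
    Σℚ (L f)                        ≡⟨ Σ-cong (λ i → sym (ℚₚ.*-identityˡ (L f i))) ⟩
    Σℚ (λ i → 1ℚ * L f i)           ≡⟨ laplacian-selfAdjoint A A-sym (λ _ → 1ℚ) f ⟩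
    Σℚ (λ i → L (λ _ → 1ℚ) i * f i) ≡⟨ Σ-cong (λ i → trans (cong (_* f i) (laplacian-const A 1ℚ i)) (ℚₚ.*-zeroˡ (f i))) ⟩
    Σℚ {n} (λ _ → 0ℚ)               ≡⟨ Σ-0 n ⟩
    0ℚ                              ∎

  -- Green's identity: pair `f` with column `k` of G and move the Laplacian across. A function is
  -- thus determined by its Laplacian up to a constant; this yields the uniqueness of passage times
  -- and of the stationary distribution.
  green-representation : ∀ f k → f k - f c ≡ Σℚ (λ i → G i k * L f i)
  green-representation f k = begin
    f k - f c
      ≡⟨ cong₂ _-_ (Σ-δ k f) (Σ-δ c f) ⟨
    Σℚ (λ i → δ i k * f i) - Σℚ (λ i → δ i c * f i)
      ≡⟨ Σ-minus (λ i → δ i k * f i) (λ i → δ i c * f i) ⟨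
    Σℚ (λ i → δ i k * f i - δ i c * f i)
      ≡⟨ Σ-cong (λ i → trans (collect (δ i k) (δ i c) (f i)) (cong (_* f i) (sym (LG≡δ k i)))) ⟩
    Σℚ (λ i → L (λ l → G l k) i * f i)
      ≡⟨ laplacian-selfAdjoint A A-sym (λ l → G l k) f ⟨
    Σℚ (λ i → G i k * L f i) ∎
    where
    collect : ∀ a b x → a * x - b * x ≡ (a - b) * x
    collect = solve-∀ ringℚ

  degree*ΣP : ∀ i (f : Fin n → ℚ) → d i * Σℚ (λ k → P A i k * f k) ≡ Σℚ (λ k → weight A i k * f k)
  degree*ΣP i f = trans (sym (Σ-*ˡ (d i) (λ k → P A i k * f k)))
    (Σ-cong (λ k → trans (sym (ℚₚ.*-assoc (d i) (P A i k) (f k))) (cong (_* f k) (degree*P A i k))))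

  module _ {m : Fin n → Fin n → ℚ} (mfpt : IsMFPT A m) where
    private M = offDiagonal m

    L-mfpt-≢ : ∀ {i j} → i ≢ j → L (λ k → M k j) i ≡ d i
    L-mfpt-≢ {i} {j} i≢j = begin
      d i * M i j - Σℚ (λ k → weight A i k * M k j)
        ≡⟨ cong₂ (λ x y → d i * x - y)
             (trans (offDiagonal-≢ m i≢j) (trans (mfpt i j i≢j) (cong (1ℚ +_) (Σ-cong (λ k → guard-*ˡ m (P A i k) k j)))))
             (sym (degree*ΣP i (λ k → M k j))) ⟩
      d i * (1ℚ + Σℚ (λ k → P A i k * M k j)) - d i * Σℚ (λ k → P A i k * M k j)
        ≡⟨ cancel (d i) (Σℚ (λ k → P A i k * M k j)) ⟩
      d i ∎
      where
      cancel : ∀ d x → d * (1ℚ + x) - d * x ≡ d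
      cancel = solve-∀ ringℚ

    -- The value at i = j is forced since the Laplacian of any function sums to 0.
    L-mfpt : ∀ j i → L (λ k → M k j) i ≡ d i - δ i j * D
    L-mfpt j i = trans (shape i) (cong (λ t → d i - δ i j * t) defect≡D)
      where
      defect : ℚ
      defect = d j - L (λ k → M k j) j
      self : ∀ a x → x ≡ a - 1ℚ * (a - x)
      self = solve-∀ ringℚ
      drop : ∀ a x → a ≡ a - 0ℚ * x
      drop = solve-∀ ringℚ
      shape : ∀ i → L (λ k → M k j) i ≡ d i - δ i j * defect
      shape i = case i Fin.≟ j of λ where
        (yes refl) → trans (self (d j) (L (λ k → M k j) j)) (cong (λ t → d j - t * defect) (sym (δ-refl j)))
        (no i≢j)   → trans (L-mfpt-≢ i≢j) (trans (drop (d i) defect) (cong (λ t → d i - t * defect) (sym (δ-≢ i≢j))))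
      defect≡D : defect ≡ D
      defect≡D = sym (x-y≡0⇒x≡y (begin
        D - defect                                    ≡⟨ cong (λ t → D - t) (Σ-δ j (λ _ → defect)) ⟨
        D - Σℚ (λ i → δ i j * defect)                 ≡⟨ Σ-minus d (λ i → δ i j * defect) ⟨
        Σℚ (λ i → d i - δ i j * defect)               ≡⟨ Σ-cong shape ⟨
        Σℚ (L (λ k → M k j))                          ≡⟨ ΣL≡0 (λ k → M k j) ⟩
        0ℚ                                            ∎))

    -- `L-mfpt` prescribes the Laplacian of column `j`, which fixes the column up to a constant; the
    -- zero at `j` fixes the constant.
    mfpt-unique : ∀ i j → M i j ≡ hitting i j
    mfpt-unique i j = begin
      M i j                                     ≡⟨ telescope (M i j) (M j j) (M c j) ⟩
      (M i j - M c j) - (M j j - M c j) + M j j ≡⟨ cong₂ _+_ (cong₂ _-_ (rep i) (rep j)) (offDiagonal-refl m j) ⟩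
      (s i - G j i * D) - (s j - G j j * D) + 0ℚ ≡⟨ cong (λ t → (s i - t * D) - (s j - G j j * D) + 0ℚ) (G-sym j i) ⟩
      (s i - G i j * D) - (s j - G j j * D) + 0ℚ ≡⟨ regroup (s i) (G i j) D (s j) (G j j) ⟩
      hitting i j                               ∎
      where
      telescope : ∀ a b x → a ≡ (a - x) - (b - x) + b
      telescope = solve-∀ ringℚ
      regroup : ∀ a g D b h → (a - g * D) - (b - h * D) + 0ℚ ≡ a - b + D * (h - g)
      regroup = solve-∀ ringℚ
      expand : ∀ g a e D → g * (a - e * D) ≡ g * a - e * (g * D)
      expand = solve-∀ ringℚ
      rep : ∀ k → M k j - M c j ≡ s k - G j k * D
      rep k = begin
        M k j - M c j
          ≡⟨ green-representation (λ l → M l j) k ⟩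
        Σℚ (λ i → G i k * L (λ l → M l j) i)
          ≡⟨ Σ-cong (λ i → trans (cong (G i k *_) (L-mfpt j i)) (expand (G i k) (d i) (δ i j) D)) ⟩
        Σℚ (λ i → G i k * d i - δ i j * (G i k * D))
          ≡⟨ Σ-minus (λ i → G i k * d i) (λ i → δ i j * (G i k * D)) ⟩
        Σℚ (λ i → G i k * d i) - Σℚ (λ i → δ i j * (G i k * D))
          ≡⟨ cong₂ _-_ (Σ-cong (λ i → cong (_* d i) (G-sym i k))) (Σ-δ j (λ i → G i k * D)) ⟩
        s k - G j k * D ∎

  1/d : Fin n → ℚ
  1/d i = ℚ.1/ d i
    where instance _ = ℚ.≢-nonZero (≢-sym (ℚₚ.<⇒≢ (degree>0 i)))

  d*1/d : ∀ i → d i * 1/d i ≡ 1ℚ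
  d*1/d i = ℚₚ.*-inverseʳ (d i)
    where instance _ = ℚ.≢-nonZero (≢-sym (ℚₚ.<⇒≢ (degree>0 i)))

  -- The density of a stationary π with respect to the degree is harmonic, hence constant.
  stationary-unique : ∀ {π} → IsStationary A π → ∀ j → D * π j ≡ d j
  stationary-unique {π} (_ , Σπ≡1 , π≡πP) j = begin
    D * π j            ≡⟨ cong (D *_) (π≡ρd j) ⟩
    D * (ρ j * d j)    ≡⟨ cong (λ t → D * (t * d j)) (ρ-const j) ⟩
    D * (ρ c * d j)    ≡⟨ rotate D (ρ c) (d j) ⟩
    ρ c * D * d j      ≡⟨ cong (_* d j) ρD≡1 ⟩
    1ℚ * d j           ≡⟨ ℚₚ.*-identityˡ (d j) ⟩
    d j                ∎
    where
    rotate : ∀ a b x → a * (b * x) ≡ b * a * x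
    rotate = solve-∀ ringℚ
    ρ : Fin n → ℚ
    ρ i = π i * 1/d i
    π≡ρd : ∀ i → π i ≡ ρ i * d i
    π≡ρd i = sym (trans (assoc′ (π i) (1/d i) (d i)) (trans (cong (π i *_) (d*1/d i)) (ℚₚ.*-identityʳ (π i))))
      where
      assoc′ : ∀ p x y → p * x * y ≡ p * (y * x)
      assoc′ = solve-∀ ringℚ
    πP : ∀ i k → π i * P A i k ≡ weight A k i * ρ i
    πP i k = begin
      π i * P A i k           ≡⟨ cong (_* P A i k) (π≡ρd i) ⟩
      ρ i * d i * P A i k     ≡⟨ swap′ (ρ i) (d i) (P A i k) ⟩
      d i * P A i k * ρ i     ≡⟨ cong (_* ρ i) (degree*P A i k) ⟩
      weight A i k * ρ i      ≡⟨ cong (λ e → ι (b2n e) * ρ i) (A-sym i k) ⟩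
      weight A k i * ρ i      ∎
      where
      swap′ : ∀ r a x → r * a * x ≡ a * x * r
      swap′ = solve-∀ ringℚ
    Lρ≡0 : ∀ i → L ρ i ≡ 0ℚ
    Lρ≡0 i = begin
      d i * ρ i - Σℚ (λ k → weight A i k * ρ k)
        ≡⟨ cong₂ _-_ (trans (ℚₚ.*-comm (d i) (ρ i)) (sym (π≡ρd i))) (Σ-cong (λ k → sym (πP k i))) ⟩
      π i - Σℚ (λ k → π k * P A k i)
        ≡⟨ cong (λ t → π i - t) (sym (π≡πP i)) ⟩
      π i - π i
        ≡⟨ ℚₚ.+-inverseʳ (π i) ⟩
      0ℚ ∎
    ρ-const : ∀ k → ρ k ≡ ρ c
    ρ-const k = x-y≡0⇒x≡y (begin
      ρ k - ρ c                  ≡⟨ green-representation ρ k ⟩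
      Σℚ (λ i → G i k * L ρ i)   ≡⟨ Σ-cong (λ i → trans (cong (G i k *_) (Lρ≡0 i)) (ℚₚ.*-zeroʳ (G i k))) ⟩
      Σℚ {n} (λ _ → 0ℚ)          ≡⟨ Σ-0 n ⟩
      0ℚ                         ∎)
    ρD≡1 : ρ c * D ≡ 1ℚ
    ρD≡1 = begin
      ρ c * D                    ≡⟨ Σ-*ˡ (ρ c) d ⟨
      Σℚ (λ i → ρ c * d i)       ≡⟨ Σ-cong (λ i → trans (cong (_* d i) (sym (ρ-const i))) (sym (π≡ρd i))) ⟩
      Σℚ π                       ≡⟨ Σπ≡1 ⟩
      1ℚ                         ∎

  -- The two contributions depending on `i` both equal D times the potential at `i` and cancel: this
  -- is the constancy of Kemeny's sum in the starting vertex. The remainder is half of dᵀ R d for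
  -- the resistance matrix R.
  Σ-hitting*degree : ∀ i → Σℚ (λ j → hitting i j * d j) ≡ D * trace A G - energy A G
  Σ-hitting*degree i = begin
    Σℚ (λ j → hitting i j * d j)
      ≡⟨ Σ-cong (λ j → expand (s i) (s j) D (G j j) (G i j) (d j)) ⟩
    Σℚ (λ j → (s i * d j - D * (G i j * d j)) + (D * (d j * G j j) - d j * s j))
      ≡⟨ Σ-+ (λ j → s i * d j - D * (G i j * d j)) (λ j → D * (d j * G j j) - d j * s j) ⟩
    Σℚ (λ j → s i * d j - D * (G i j * d j)) + Σℚ (λ j → D * (d j * G j j) - d j * s j)
      ≡⟨ cong₂ _+_
           (trans (Σ-minus (λ j → s i * d j) (λ j → D * (G i j * d j)))
                  (cong₂ _-_ (Σ-*ˡ (s i) d) (Σ-*ˡ D (λ j → G i j * d j))))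
           (trans (Σ-minus (λ j → D * (d j * G j j)) (λ j → d j * s j))
                  (cong (_- energy A G) (Σ-*ˡ D (λ j → d j * G j j)))) ⟩
    (s i * D - D * s i) + (D * trace A G - energy A G)
      ≡⟨ cancel (s i) D (D * trace A G - energy A G) ⟩
    D * trace A G - energy A G ∎
    where
    expand : ∀ a b D g h e → (a - b + D * (g - h)) * e ≡ (a * e - D * (h * e)) + (D * (e * g) - e * b)
    expand = solve-∀ ringℚ
    cancel : ∀ a D x → (a * D - D * a) + x ≡ x
    cancel = solve-∀ ringℚ

  kemeny-value : ∀ {κ} → IsKemeny A κ → D * κ ≡ D * trace A G - energy A G
  kemeny-value {κ} (π , m , stat , mfpt , κ≡) = begin
    D * κ
      ≡⟨ cong (D *_) (κ≡ c) ⟩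
    D * Σℚ (λ j → if toℕ j ℕ.≡ᵇ toℕ c then 0ℚ else m c j * π j)
      ≡⟨ cong (D *_) (Σ-cong (λ j → trans (guard-*ʳ m (π j) c j) (cong (_* π j) (mfpt-unique mfpt c j)))) ⟩
    D * Σℚ (λ j → hitting c j * π j)
      ≡⟨ Σ-*ˡ D (λ j → hitting c j * π j) ⟨
    Σℚ (λ j → D * (hitting c j * π j))
      ≡⟨ Σ-cong (λ j → trans (rotate D (hitting c j) (π j)) (cong (hitting c j *_) (stationary-unique stat j))) ⟩
    Σℚ (λ j → hitting c j * d j)
      ≡⟨ Σ-hitting*degree c ⟩
    D * trace A G - energy A G ∎
    where
    rotate : ∀ D h p → D * (h * p) ≡ h * (D * p)
    rotate = solve-∀ ringℚ

  -- Supplies the witnesses that `IsBraess` demands: the distribution d / D together with `hitting`.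
  kemeny-exists : Σ ℚ (IsKemeny A)
  kemeny-exists = w * (D * trace A G - energy A G) , π , hitting , (π≥0 , Σπ≡1 , π≡πP) , mfpt , κ≡
    where
    instance D≢0 = ℚ.≢-nonZero (≢-sym (ℚₚ.<⇒≢ volume>0))
    instance D-pos = ℚ.positive volume>0
    w : ℚ
    w = ℚ.1/ D
    π : Fin n → ℚ
    π j = w * d j
    π≥0 : ∀ j → 0ℚ ℚ.≤ π j
    π≥0 j = subst (ℚ._≤ π j) (ℚₚ.*-zeroʳ w) (ℚₚ.*-monoˡ-≤-nonNeg w {{ℚₚ.pos⇒nonNeg w {{ℚₚ.1/pos⇒pos D}}}} (ℚₚ.<⇒≤ (degree>0 j)))
    Σπ≡1 : Σℚ π ≡ 1ℚ
    Σπ≡1 = trans (Σ-*ˡ w d) (ℚₚ.*-inverseˡ D)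
    π≡πP : ∀ j → π j ≡ Σℚ (λ i → π i * P A i j)
    π≡πP j = begin
      w * d j                        ≡⟨ Σ-*ˡ w (weight A j) ⟨
      Σℚ (λ i → w * weight A j i)    ≡⟨ Σ-cong (λ i → cong (λ e → w * ι (b2n e)) (A-sym j i)) ⟩
      Σℚ (λ i → w * weight A i j)    ≡⟨ Σ-cong (λ i → trans (cong (w *_) (sym (degree*P A i j))) (sym (ℚₚ.*-assoc w (d i) (P A i j)))) ⟩
      Σℚ (λ i → π i * P A i j)       ∎
    -- `hitting` vanishes on the diagonal, so the guard in `IsMFPT` removes only a zero term.
    guard : ∀ x k j → (if toℕ k ℕ.≡ᵇ toℕ j then 0ℚ else x * hitting k j) ≡ x * hitting k j
    guard x k j rewrite toℕ-≡ᵇ k j with k Fin.≟ j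
    ... | yes refl = sym (trans (cong (x *_) (hitting-refl k)) (ℚₚ.*-zeroʳ x))
    ... | no _     = refl
    mfpt : IsMFPT A hitting
    mfpt i j i≢j = *-cancelˡ-≡-pos (degree>0 i) (begin
      d i * hitting i j
        ≡⟨ add (d i * hitting i j) (Σℚ (λ k → weight A i k * hitting k j)) ⟩
      L (λ k → hitting k j) i + Σℚ (λ k → weight A i k * hitting k j)
        ≡⟨ cong₂ _+_ (trans (L-hitting j i) (trans (cong (λ t → d i - t * D) (δ-≢ i≢j)) (drop (d i) D))) (sym (degree*ΣP i (λ k → hitting k j))) ⟩
      d i * 1ℚ + d i * Σℚ (λ k → P A i k * hitting k j)
        ≡⟨ ℚₚ.*-distribˡ-+ (d i) 1ℚ (Σℚ (λ k → P A i k * hitting k j)) ⟨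
      d i * (1ℚ + Σℚ (λ k → P A i k * hitting k j))
        ≡⟨ cong (λ t → d i * (1ℚ + t)) (Σ-cong (λ k → sym (guard (P A i k) k j))) ⟩
      d i * (1ℚ + Σℚ (λ k → if toℕ k ℕ.≡ᵇ toℕ j then 0ℚ else P A i k * hitting k j)) ∎)
      where
      add : ∀ x y → x ≡ (x - y) + y
      add = solve-∀ ringℚ
      drop : ∀ x D → x - 0ℚ * D ≡ x * 1ℚ
      drop = solve-∀ ringℚ
    guardʳ : ∀ x i j → (if toℕ j ℕ.≡ᵇ toℕ i then 0ℚ else hitting i j * x) ≡ hitting i j * x
    guardʳ x i j rewrite toℕ-≡ᵇ j i with j Fin.≟ i
    ... | yes refl = sym (trans (cong (_* x) (hitting-refl j)) (ℚₚ.*-zeroˡ x))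
    ... | no _     = refl
    κ≡ : ∀ i → w * (D * trace A G - energy A G) ≡ Σℚ (λ j → if toℕ j ℕ.≡ᵇ toℕ i then 0ℚ else hitting i j * π j)
    κ≡ i = begin
      w * (D * trace A G - energy A G)      ≡⟨ cong (w *_) (Σ-hitting*degree i) ⟨
      w * Σℚ (λ j → hitting i j * d j)      ≡⟨ Σ-*ˡ w (λ j → hitting i j * d j) ⟨
      Σℚ (λ j → w * (hitting i j * d j))    ≡⟨ Σ-cong (λ j → trans (rotate w (hitting i j) (d j)) (sym (guardʳ (π j) i j))) ⟩
      Σℚ (λ j → if toℕ j ℕ.≡ᵇ toℕ i then 0ℚ else hitting i j * π j) ∎
      where
      rotate : ∀ w h e → w * (h * e) ≡ h * (w * e)
      rotate = solve-∀ ringℚ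

-- Adding an edge

2ℚ : ℚ
2ℚ = 1ℚ + 1ℚ

indicator-∧ : ∀ p q → (if p ∧ q then 1ℚ else 0ℚ) ≡ (if p then 1ℚ else 0ℚ) * (if q then 1ℚ else 0ℚ)
indicator-∧ true  true  = refl
indicator-∧ true  false = refl
indicator-∧ false true  = refl
indicator-∧ false false = refl

-- Disjunction is addition when at most one of the three is true. For `addEdge` the old edge and the
-- two orientations of the new one exclude each other because `u` and `v` are distinct and
-- nonadjacent.
ι-b2n-∨ : ∀ a p q → (p ≡ true → a ≡ false) → (q ≡ true → a ≡ false) → (p ≡ true → q ≡ true → ⊥) →
          ι (b2n (a ∨ p ∨ q)) ≡ ι (b2n a) + ((if p then 1ℚ else 0ℚ) + (if q then 1ℚ else 0ℚ))
ι-b2n-∨ true  true  q     ¬ap _   _   = contradiction (¬ap refl) λ ()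
ι-b2n-∨ true  false true  _   ¬aq _   = contradiction (¬aq refl) λ ()
ι-b2n-∨ true  false false _   _   _   = refl
ι-b2n-∨ false true  true  _   _   ¬pq = contradiction refl (¬pq refl)
ι-b2n-∨ false true  false _   _   _   = refl
ι-b2n-∨ false false true  _   _   _   = refl
ι-b2n-∨ false false false _   _   _   = refl

does-∧ : ∀ {n} (i j k l : Fin n) → does (i Fin.≟ j) ∧ does (k Fin.≟ l) ≡ true → i ≡ j × k ≡ l
does-∧ i j k l eq with i Fin.≟ j | k Fin.≟ l
... | yes i≡j | yes k≡l = i≡j , k≡l

module AddEdge {n} {A : Graph n} {c : Fin n} {G : Fin n → Fin n → ℚ} (green : IsGreen A c G)
               {u v : Fin n} (u≢v : u ≢ v) (uv∉A : A u v ≡ false) where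
  open IsGreen green

  A′ : Graph n
  A′ = addEdge A u v

  private
    d = degree A
    s = potential A G

  dipole : Fin n → ℚ
  dipole i = G i u - G i v

  private g = dipole

  weight-addEdge : ∀ i k → weight A′ i k ≡ weight A i k + (δ i u * δ k v + δ i v * δ k u)
  weight-addEdge i k
    rewrite toℕ-≡ᵇ i u | toℕ-≡ᵇ k v | toℕ-≡ᵇ i v | toℕ-≡ᵇ k u
    = trans (ι-b2n-∨ (A i k) (does (i Fin.≟ u) ∧ does (k Fin.≟ v)) (does (i Fin.≟ v) ∧ does (k Fin.≟ u)) new new′ disjoint)
            (cong (weight A i k +_) (cong₂ _+_ (indicator-∧ (does (i Fin.≟ u)) (does (k Fin.≟ v)))
                                               (indicator-∧ (does (i Fin.≟ v)) (does (k Fin.≟ u)))))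
    where
    new : does (i Fin.≟ u) ∧ does (k Fin.≟ v) ≡ true → A i k ≡ false
    new eq with does-∧ i u k v eq
    ... | refl , refl = uv∉A
    new′ : does (i Fin.≟ v) ∧ does (k Fin.≟ u) ≡ true → A i k ≡ false
    new′ eq with does-∧ i v k u eq
    ... | refl , refl = trans (A-sym v u) uv∉A
    disjoint : does (i Fin.≟ u) ∧ does (k Fin.≟ v) ≡ true → does (i Fin.≟ v) ∧ does (k Fin.≟ u) ≡ true → ⊥
    disjoint eq eq′ with does-∧ i u k v eq | does-∧ i v k u eq′
    ... | i≡u , _ | i≡v , _ = u≢v (trans (sym i≡u) i≡v)

  Σ-weight-addEdge : ∀ i f → Σℚ (λ k → weight A′ i k * f k) ≡ Σℚ (λ k → weight A i k * f k) + (δ i u * f v + δ i v * f u)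
  Σ-weight-addEdge i f = begin
    Σℚ (λ k → weight A′ i k * f k)
      ≡⟨ Σ-cong (λ k → trans (cong (_* f k) (weight-addEdge i k)) (expand (weight A i k) (δ i u) (δ k v) (δ i v) (δ k u) (f k))) ⟩
    Σℚ (λ k → weight A i k * f k + (δ i u * (δ k v * f k) + δ i v * (δ k u * f k)))
      ≡⟨ Σ-+ (λ k → weight A i k * f k) (λ k → δ i u * (δ k v * f k) + δ i v * (δ k u * f k)) ⟩
    Σℚ (λ k → weight A i k * f k) + Σℚ (λ k → δ i u * (δ k v * f k) + δ i v * (δ k u * f k))
      ≡⟨ cong (Σℚ (λ k → weight A i k * f k) +_) (Σ-+ (λ k → δ i u * (δ k v * f k)) (λ k → δ i v * (δ k u * f k))) ⟩
    Σℚ (λ k → weight A i k * f k) + (Σℚ (λ k → δ i u * (δ k v * f k)) + Σℚ (λ k → δ i v * (δ k u * f k)))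
      ≡⟨ cong (Σℚ (λ k → weight A i k * f k) +_) (cong₂ _+_ (point (δ i u) v) (point (δ i v) u)) ⟩
    Σℚ (λ k → weight A i k * f k) + (δ i u * f v + δ i v * f u) ∎
    where
    expand : ∀ a p q r s x → (a + (p * q + r * s)) * x ≡ a * x + (p * (q * x) + r * (s * x))
    expand = solve-∀ ringℚ
    point : ∀ x l → Σℚ (λ k → x * (δ k l * f k)) ≡ x * f l
    point x l = trans (Σ-*ˡ x (λ k → δ k l * f k)) (cong (x *_) (Σ-δ l f))

  degree-addEdge : ∀ i → degree A′ i ≡ d i + (δ i u + δ i v)
  degree-addEdge i = begin
    degree A′ i                                              ≡⟨ Σ-cong (λ k → sym (ℚₚ.*-identityʳ (weight A′ i k))) ⟩
    Σℚ (λ k → weight A′ i k * 1ℚ)                            ≡⟨ Σ-weight-addEdge i (λ _ → 1ℚ) ⟩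
    Σℚ (λ k → weight A i k * 1ℚ) + (δ i u * 1ℚ + δ i v * 1ℚ) ≡⟨ cong₂ _+_ (Σ-cong (λ k → ℚₚ.*-identityʳ (weight A i k)))
                                                                  (cong₂ _+_ (ℚₚ.*-identityʳ (δ i u)) (ℚₚ.*-identityʳ (δ i v))) ⟩
    d i + (δ i u + δ i v)                                    ∎

  -- The increment is the rank-one matrix (e_u - e_v)(e_u - e_v)ᵀ, which is what makes a
  -- Sherman-Morrison update possible.
  laplacian-addEdge : ∀ f i → laplacian A′ f i ≡ laplacian A f i + (δ i u - δ i v) * (f u - f v)
  laplacian-addEdge f i = begin
    degree A′ i * f i - Σℚ (λ k → weight A′ i k * f k)
      ≡⟨ cong₂ (λ x y → x * f i - y) (degree-addEdge i) (Σ-weight-addEdge i f) ⟩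
    (d i + (δ i u + δ i v)) * f i - (S + (δ i u * f v + δ i v * f u))
      ≡⟨ expand (d i) (δ i u) (δ i v) (f i) S (f u) (f v) ⟩
    d i * f i - S + (δ i u * f i + δ i v * f i - (δ i u * f v + δ i v * f u))
      ≡⟨ cong (λ t → d i * f i - S + (t - (δ i u * f v + δ i v * f u))) (cong₂ _+_ (δ-subst i u f) (δ-subst i v f)) ⟩
    d i * f i - S + (δ i u * f u + δ i v * f v - (δ i u * f v + δ i v * f u))
      ≡⟨ collect (d i * f i - S) (δ i u) (δ i v) (f u) (f v) ⟩
    laplacian A f i + (δ i u - δ i v) * (f u - f v) ∎
    where
    S = Σℚ (λ k → weight A i k * f k)
    expand : ∀ d p q x S y z → (d + (p + q)) * x - (S + (p * z + q * y)) ≡ d * x - S + (p * x + q * x - (p * z + q * y))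
    expand = solve-∀ ringℚ
    collect : ∀ l p q y z → l + (p * y + q * z - (p * z + q * y)) ≡ l + (p - q) * (y - z)
    collect = solve-∀ ringℚ

  Σ-degree-addEdge : ∀ f → Σℚ (λ j → degree A′ j * f j) ≡ Σℚ (λ j → d j * f j) + (f u + f v)
  Σ-degree-addEdge f = begin
    Σℚ (λ j → degree A′ j * f j)
      ≡⟨ Σ-cong (λ j → trans (cong (_* f j) (degree-addEdge j)) (expand (d j) (δ j u) (δ j v) (f j))) ⟩
    Σℚ (λ j → d j * f j + (δ j u * f j + δ j v * f j))
      ≡⟨ Σ-+ (λ j → d j * f j) (λ j → δ j u * f j + δ j v * f j) ⟩
    Σℚ (λ j → d j * f j) + Σℚ (λ j → δ j u * f j + δ j v * f j)
      ≡⟨ cong (Σℚ (λ j → d j * f j) +_) (trans (Σ-+ (λ j → δ j u * f j) (λ j → δ j v * f j)) (cong₂ _+_ (Σ-δ u f) (Σ-δ v f))) ⟩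
    Σℚ (λ j → d j * f j) + (f u + f v) ∎
    where
    expand : ∀ d p q x → (d + (p + q)) * x ≡ d * x + (p * x + q * x)
    expand = solve-∀ ringℚ

  volume-addEdge : volume A′ ≡ volume A + 2ℚ
  volume-addEdge = begin
    Σℚ (degree A′)                    ≡⟨ Σ-cong (λ j → sym (ℚₚ.*-identityʳ (degree A′ j))) ⟩
    Σℚ (λ j → degree A′ j * 1ℚ)       ≡⟨ Σ-degree-addEdge (λ _ → 1ℚ) ⟩
    Σℚ (λ j → d j * 1ℚ) + 2ℚ          ≡⟨ cong (_+ 2ℚ) (Σ-cong (λ j → ℚₚ.*-identityʳ (d j))) ⟩
    volume A + 2ℚ                     ∎

  -- An entry of G diag(d) G, by symmetry of G. It enters because the trace of diag(d) g gᵀ is the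
  -- sum of d j (g j)² with g a difference of two columns.
  gram : Fin n → Fin n → ℚ
  gram x y = Σℚ (λ j → d j * (G j x * G j y))

  Σ-degree*G : ∀ x → Σℚ (λ j → d j * G j x) ≡ s x
  Σ-degree*G x = Σ-cong (λ j → trans (ℚₚ.*-comm (d j) (G j x)) (cong (_* d j) (G-sym j x)))

  Σ-degree*dipole : Σℚ (λ j → d j * g j) ≡ s u - s v
  Σ-degree*dipole = begin
    Σℚ (λ j → d j * (G j u - G j v))                   ≡⟨ Σ-cong (λ j → expand (d j) (G j u) (G j v)) ⟩
    Σℚ (λ j → d j * G j u - d j * G j v)               ≡⟨ Σ-minus (λ j → d j * G j u) (λ j → d j * G j v) ⟩
    Σℚ (λ j → d j * G j u) - Σℚ (λ j → d j * G j v)    ≡⟨ cong₂ _-_ (Σ-degree*G u) (Σ-degree*G v) ⟩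
    s u - s v                                          ∎
    where
    expand : ∀ d x y → d * (x - y) ≡ d * x - d * y
    expand = solve-∀ ringℚ

  Σ-degree*dipole² : Σℚ (λ j → d j * (g j * g j)) ≡ gram u u + gram v v - 2ℚ * gram u v
  Σ-degree*dipole² = begin
    Σℚ (λ j → d j * (g j * g j))
      ≡⟨ Σ-cong (λ j → expand (d j) (G j u) (G j v)) ⟩
    Σℚ (λ j → (d j * (G j u * G j u) + d j * (G j v * G j v)) - 2ℚ * (d j * (G j u * G j v)))
      ≡⟨ Σ-minus (λ j → d j * (G j u * G j u) + d j * (G j v * G j v)) (λ j → 2ℚ * (d j * (G j u * G j v))) ⟩
    Σℚ (λ j → d j * (G j u * G j u) + d j * (G j v * G j v)) - Σℚ (λ j → 2ℚ * (d j * (G j u * G j v)))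
      ≡⟨ cong₂ _-_ (Σ-+ (λ j → d j * (G j u * G j u)) (λ j → d j * (G j v * G j v))) (Σ-*ˡ 2ℚ (λ j → d j * (G j u * G j v))) ⟩
    gram u u + gram v v - 2ℚ * gram u v ∎
    where
    expand : ∀ d x y → d * ((x - y) * (x - y)) ≡ (d * (x * x) + d * (y * y)) - (1ℚ + 1ℚ) * (d * (x * y))
    expand = solve-∀ ringℚ

  -- Sherman–Morrison: g u - g v is the effective resistance between u and v.
  module Update (w : ℚ) (w-inv : w * (1ℚ + (g u - g v)) ≡ 1ℚ) where

    G′ : Fin n → Fin n → ℚ
    G′ i j = G i j - w * (g i * g j)

    isGreen : IsGreen A′ c G′
    isGreen = record
      { A-sym    = λ i j → cong₂ _∨_ (A-sym i j) (reverse (toℕ i ℕ.≡ᵇ toℕ u) (toℕ j ℕ.≡ᵇ toℕ v) (toℕ i ℕ.≡ᵇ toℕ v) (toℕ j ℕ.≡ᵇ toℕ u))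
      ; degree>0 = λ i → subst (0ℚ ℚ.<_) (sym (degree-addEdge i)) (ℚₚ.+-mono-<-≤ (degree>0 i) (ℚₚ.+-mono-≤ (δ≥0 i u) (δ≥0 i v)))
      ; G-sym    = λ i j → cong₂ (λ x y → x - w * y) (G-sym i j) (ℚₚ.*-comm (g i) (g j))
      ; LG≡δ     = LG′≡δ
      }
      where
      reverse : ∀ p q r s → (p ∧ q) ∨ (r ∧ s) ≡ (s ∧ r) ∨ (q ∧ p)
      reverse p q r s = trans (∨-comm (p ∧ q) (r ∧ s)) (cong₂ _∨_ (∧-comm r s) (∧-comm p q))
      δ≥0 : ∀ i j → 0ℚ ℚ.≤ δ {n} i j
      δ≥0 i j with does (i Fin.≟ j)
      ... | true  = ℚₚ.nonNegative⁻¹ 1ℚ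
      ... | false = ℚₚ.≤-refl
      L-dipole : ∀ i → laplacian A g i ≡ δ i u - δ i v
      L-dipole i = begin
        laplacian A (λ k → G k u - G k v) i
          ≡⟨ laplacian-cong A (λ k → arrange (G k u) (G k v)) i ⟩
        laplacian A (λ k → 1ℚ * G k u + (- 1ℚ) * G k v) i
          ≡⟨ laplacian-linear A 1ℚ (λ k → G k u) (- 1ℚ) (λ k → G k v) i ⟩
        1ℚ * laplacian A (λ k → G k u) i + (- 1ℚ) * laplacian A (λ k → G k v) i
          ≡⟨ cong₂ (λ x y → 1ℚ * x + (- 1ℚ) * y) (LG≡δ u i) (LG≡δ v i) ⟩
        1ℚ * (δ i u - δ i c) + (- 1ℚ) * (δ i v - δ i c)
          ≡⟨ cancel (δ i u) (δ i v) (δ i c) ⟩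
        δ i u - δ i v ∎
        where
        arrange : ∀ x y → x - y ≡ 1ℚ * x + (- 1ℚ) * y
        arrange = solve-∀ ringℚ
        cancel : ∀ x y z → 1ℚ * (x - z) + (- 1ℚ) * (y - z) ≡ x - y
        cancel = solve-∀ ringℚ
      LG′≡δ : ∀ j i → laplacian A′ (λ k → G′ k j) i ≡ δ i j - δ i c
      LG′≡δ j i = begin
        laplacian A′ (λ k → G′ k j) i
          ≡⟨ laplacian-addEdge (λ k → G′ k j) i ⟩
        laplacian A (λ k → G′ k j) i + (δ i u - δ i v) * (G′ u j - G′ v j)
          ≡⟨ cong (_+ (δ i u - δ i v) * (G′ u j - G′ v j)) (trans (laplacian-cong A (λ k → arrange (G k j) w (g k) (g j)) i)
                        (laplacian-linear A 1ℚ (λ k → G k j) (- (w * g j)) g i)) ⟩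
        (1ℚ * laplacian A (λ k → G k j) i + (- (w * g j)) * laplacian A g i) + (δ i u - δ i v) * (G′ u j - G′ v j)
          ≡⟨ cong₂ (λ x y → (1ℚ * x + (- (w * g j)) * y) + (δ i u - δ i v) * (G′ u j - G′ v j)) (LG≡δ j i) (L-dipole i) ⟩
        (1ℚ * (δ i j - δ i c) + (- (w * g j)) * (δ i u - δ i v)) + (δ i u - δ i v) * (G′ u j - G′ v j)
          ≡⟨ cong (λ t → (1ℚ * (δ i j - δ i c) + (- (w * g j)) * (δ i u - δ i v)) + (δ i u - δ i v) * t)
               (trans (regroup (G u j) (G v j) w (g u) (g v) (g j)) (cong₂ (λ x y → x - y - w * ((g u - g v) * g j)) (G-sym u j) (G-sym v j))) ⟩
        (1ℚ * (δ i j - δ i c) + (- (w * g j)) * (δ i u - δ i v)) + (δ i u - δ i v) * (g j - w * ((g u - g v) * g j))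
          ≡⟨ collect (δ i j - δ i c) w (g j) (δ i u - δ i v) (g u - g v) ⟩
        -- All corrections collect into one multiple of 1 - w (1 + g u - g v), which the choice of
        -- `w` makes 0; the root `c` is unchanged.
        (δ i j - δ i c) + (δ i u - δ i v) * g j * (1ℚ - w * (1ℚ + (g u - g v)))
          ≡⟨ cong (λ t → (δ i j - δ i c) + (δ i u - δ i v) * g j * (1ℚ - t)) w-inv ⟩
        (δ i j - δ i c) + (δ i u - δ i v) * g j * (1ℚ - 1ℚ)
          ≡⟨ vanish (δ i j - δ i c) ((δ i u - δ i v) * g j) ⟩
        δ i j - δ i c ∎
        where
        arrange : ∀ x w y z → x - w * (y * z) ≡ 1ℚ * x + (- (w * z)) * y
        arrange = solve-∀ ringℚ
        regroup : ∀ x y w p q z → (x - w * (p * z)) - (y - w * (q * z)) ≡ x - y - w * ((p - q) * z)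
        regroup = solve-∀ ringℚ
        collect : ∀ e w z b r → (1ℚ * e + (- (w * z)) * b) + b * (z - w * (r * z)) ≡ e + b * z * (1ℚ - w * (1ℚ + r))
        collect = solve-∀ ringℚ
        vanish : ∀ e x → e + x * (1ℚ - 1ℚ) ≡ e
        vanish = solve-∀ ringℚ

    trace-addEdge : trace A′ G′ ≡ trace A G - w * (gram u u + gram v v - 2ℚ * gram u v) + (G′ u u + G′ v v)
    trace-addEdge = begin
      trace A′ G′
        ≡⟨ Σ-degree-addEdge (λ j → G′ j j) ⟩
      Σℚ (λ j → d j * G′ j j) + (G′ u u + G′ v v)
        ≡⟨ cong (_+ (G′ u u + G′ v v)) (trans (Σ-cong (λ j → expand (d j) (G j j) w (g j * g j))) (Σ-minus (λ j → d j * G j j) (λ j → w * (d j * (g j * g j))))) ⟩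
      trace A G - Σℚ (λ j → w * (d j * (g j * g j))) + (G′ u u + G′ v v)
        ≡⟨ cong (λ t → trace A G - t + (G′ u u + G′ v v)) (trans (Σ-*ˡ w (λ j → d j * (g j * g j))) (cong (w *_) Σ-degree*dipole²)) ⟩
      trace A G - w * (gram u u + gram v v - 2ℚ * gram u v) + (G′ u u + G′ v v) ∎
      where
      expand : ∀ d x w y → d * (x - w * y) ≡ d * x - w * (d * y)
      expand = solve-∀ ringℚ

    potential-addEdge : ∀ i → potential A′ G′ i ≡ s i + (G i u + G i v) - w * (s u - s v + (g u + g v)) * g i
    potential-addEdge i = begin
      Σℚ (λ k → G′ i k * degree A′ k)
        ≡⟨ Σ-cong (λ k → ℚₚ.*-comm (G′ i k) (degree A′ k)) ⟩
      Σℚ (λ k → degree A′ k * G′ i k)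
        ≡⟨ Σ-degree-addEdge (λ k → G′ i k) ⟩
      Σℚ (λ k → d k * G′ i k) + (G′ i u + G′ i v)
        ≡⟨ cong (_+ (G′ i u + G′ i v)) (trans (Σ-cong (λ k → expand (d k) (G i k) w (g i) (g k)))
             (trans (Σ-minus (λ k → G i k * d k) (λ k → (w * g i) * (d k * g k)))
                    (cong (λ t → s i - t) (trans (Σ-*ˡ (w * g i) (λ k → d k * g k)) (cong ((w * g i) *_) Σ-degree*dipole))))) ⟩
      s i - (w * g i) * (s u - s v) + (G′ i u + G′ i v)
        ≡⟨ collect (s i) w (g i) (s u - s v) (G i u) (G i v) (g u) (g v) ⟩
      s i + (G i u + G i v) - w * (s u - s v + (g u + g v)) * g i ∎
      where
      expand : ∀ d x w y z → d * (x - w * (y * z)) ≡ x * d - (w * y) * (d * z)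
      expand = solve-∀ ringℚ
      collect : ∀ s w z γ x y p q → s - (w * z) * γ + ((x - w * (z * p)) + (y - w * (z * q))) ≡ s + (x + y) - w * (γ + (p + q)) * z
      collect = solve-∀ ringℚ

    -- Put d′ = d + e_u + e_v. The positive terms are d′ᵀ G d′, and the update subtracts `w` times
    -- the square of d′ · g, which equals s u - s v + (g u + g v).
    energy-addEdge : energy A′ G′ ≡ energy A G + 2ℚ * (s u + s v) + (G u u + G v v + 2ℚ * G u v)
                                    - w * ((s u - s v + (g u + g v)) * (s u - s v + (g u + g v)))
    energy-addEdge = begin
      energy A′ G′
        ≡⟨ Σ-cong (λ j → cong (degree A′ j *_) (potential-addEdge j)) ⟩
      Σℚ (λ j → degree A′ j * (s j + (G j u + G j v) - w * x * g j))
        ≡⟨ Σ-degree-addEdge (λ j → s j + (G j u + G j v) - w * x * g j) ⟩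
      Σℚ (λ j → d j * (s j + (G j u + G j v) - w * x * g j)) + p
        ≡⟨ cong (_+ p) sum ⟩
      (energy A G + (s u + s v)) - w * x * (s u - s v) + p
        ≡⟨ cong (λ t → (energy A G + (s u + s v)) - w * x * (s u - s v) + ((s u + (G u u + G u v) - w * x * g u) + (s v + (t + G v v) - w * x * g v))) (G-sym v u) ⟩
      (energy A G + (s u + s v)) - w * x * (s u - s v) + ((s u + (G u u + G u v) - w * x * g u) + (s v + (G u v + G v v) - w * x * g v))
        ≡⟨ collect (energy A G) (s u) (s v) (G u u) (G u v) (G v v) w (g u) (g v) ⟩
      energy A G + 2ℚ * (s u + s v) + (G u u + G v v + 2ℚ * G u v) - w * (x * x) ∎
      where
      x p : ℚ
      x = s u - s v + (g u + g v)
      p = (s u + (G u u + G u v) - w * x * g u) + (s v + (G v u + G v v) - w * x * g v)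
      expand : ∀ d s a b y z → d * (s + (a + b) - y * z) ≡ (d * s + (d * a + d * b)) - y * (d * z)
      expand = solve-∀ ringℚ
      sum : Σℚ (λ j → d j * (s j + (G j u + G j v) - w * x * g j)) ≡ (energy A G + (s u + s v)) - w * x * (s u - s v)
      sum = begin
        Σℚ (λ j → d j * (s j + (G j u + G j v) - w * x * g j))
          ≡⟨ Σ-cong (λ j → expand (d j) (s j) (G j u) (G j v) (w * x) (g j)) ⟩
        Σℚ (λ j → (d j * s j + (d j * G j u + d j * G j v)) - w * x * (d j * g j))
          ≡⟨ Σ-minus (λ j → d j * s j + (d j * G j u + d j * G j v)) (λ j → w * x * (d j * g j)) ⟩
        Σℚ (λ j → d j * s j + (d j * G j u + d j * G j v)) - Σℚ (λ j → w * x * (d j * g j))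
          ≡⟨ cong₂ _-_
               (trans (Σ-+ (λ j → d j * s j) (λ j → d j * G j u + d j * G j v))
                      (cong (energy A G +_) (trans (Σ-+ (λ j → d j * G j u) (λ j → d j * G j v)) (cong₂ _+_ (Σ-degree*G u) (Σ-degree*G v)))))
               (trans (Σ-*ˡ (w * x) (λ j → d j * g j)) (cong ((w * x) *_) Σ-degree*dipole)) ⟩
        (energy A G + (s u + s v)) - w * x * (s u - s v) ∎
      collect : ∀ q a b e f h w y z →
        (q + (a + b)) - w * (a - b + (y + z)) * (a - b) + ((a + (e + f) - w * (a - b + (y + z)) * y) + (b + (f + h) - w * (a - b + (y + z)) * z))
        ≡ q + (1ℚ + 1ℚ) * (a + b) + (e + h + (1ℚ + 1ℚ) * f) - w * ((a - b + (y + z)) * (a - b + (y + z)))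
      collect = solve-∀ ringℚ

-- The numerator of κ′ - κ over D (D + 2), where κ = T - q / D and κ′ = T + τ - (q + ε) / (D + 2);
-- the trace T cancels.
change : ℚ → ℚ → ℚ → ℚ → ℚ
change D q τ ε = D * (D + 2ℚ) * τ - D * ε + 2ℚ * q

module _ {n} {A : Graph n} {c : Fin n} {G : Fin n → Fin n → ℚ} (green : IsGreen A c G)
         {u v : Fin n} (u≢v : u ≢ v) (uv∉A : A u v ≡ false) where
  open AddEdge green u≢v uv∉A

  kemeny-change : ∀ w (w-inv : w * (1ℚ + (dipole u - dipole v)) ≡ 1ℚ) →
    let open Update w w-inv in
    ∀ {κ κ′ τ ε} → IsKemeny A κ → IsKemeny A′ κ′ →
    trace A′ G′ ≡ trace A G + τ → energy A′ G′ ≡ energy A G + ε →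
    volume A * (volume A + 2ℚ) * (κ′ - κ) ≡ change (volume A) (energy A G) τ ε
  kemeny-change w w-inv {κ} {κ′} {τ} {ε} kem kem′ τ≡ ε≡ = begin
    D * (D + 2ℚ) * (κ′ - κ)
      ≡⟨ expand D κ κ′ ⟩
    D * ((D + 2ℚ) * κ′) - (D + 2ℚ) * (D * κ)
      ≡⟨ cong₂ (λ x y → D * x - (D + 2ℚ) * y) kem′≡ (Kemeny.kemeny-value green kem) ⟩
    D * ((D + 2ℚ) * (trace A G + τ) - (energy A G + ε)) - (D + 2ℚ) * (D * trace A G - energy A G)
      ≡⟨ cancel D (trace A G) τ (energy A G) ε ⟩
    change D (energy A G) τ ε ∎
    where
    D = volume A
    open Update w w-inv
    kem′≡ : (D + 2ℚ) * κ′ ≡ (D + 2ℚ) * (trace A G + τ) - (energy A G + ε)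
    kem′≡ = begin
      (D + 2ℚ) * κ′                                           ≡⟨ cong (_* κ′) volume-addEdge ⟨
      volume A′ * κ′                                          ≡⟨ Kemeny.kemeny-value isGreen kem′ ⟩
      volume A′ * trace A′ G′ - energy A′ G′                  ≡⟨ cong₂ _-_ (cong₂ _*_ volume-addEdge τ≡) ε≡ ⟩
      (D + 2ℚ) * (trace A G + τ) - (energy A G + ε)           ∎
    expand : ∀ D k k′ → D * (D + (1ℚ + 1ℚ)) * (k′ - k) ≡ D * ((D + (1ℚ + 1ℚ)) * k′) - (D + (1ℚ + 1ℚ)) * (D * k)
    expand = solve-∀ ringℚ
    cancel : ∀ D T τ q ε → D * ((D + (1ℚ + 1ℚ)) * (T + τ) - (q + ε)) - (D + (1ℚ + 1ℚ)) * (D * T - q)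
                           ≡ D * (D + (1ℚ + 1ℚ)) * τ - D * ε + (1ℚ + 1ℚ) * q
    cancel = solve-∀ ringℚ

-- Signs of quadratic polynomials on a quadrant

x<y⇒0<y-x : ∀ {x y} → x ℚ.< y → 0ℚ ℚ.< y - x
x<y⇒0<y-x {x} {y} x<y = subst (ℚ._< y - x) (ℚₚ.+-inverseʳ x) (ℚₚ.+-monoˡ-< (- x) x<y)

0<y-x⇒x<y : ∀ {x y} → 0ℚ ℚ.< y - x → x ℚ.< y
0<y-x⇒x<y {x} {y} 0<y-x = subst₂ ℚ._<_ (ℚₚ.+-identityʳ x) (restore x y) (ℚₚ.+-monoʳ-< x 0<y-x)
  where
  restore : ∀ x y → x + (y - x) ≡ y
  restore = solve-∀ ringℚ

quadratic : ℚ → ℚ → ℚ → ℚ → ℚ → ℚ → ℚ → ℚ → ℚ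
quadratic c₀ c₁ c₂ c₃ c₄ c₅ x y = c₀ + c₁ * x + c₂ * (x * x) + c₃ * y + c₄ * (y * y) + c₅ * (x * y)

0≤* : ∀ {x y} → 0ℚ ℚ.≤ x → 0ℚ ℚ.≤ y → 0ℚ ℚ.≤ x * y
0≤* {x} {y} 0≤x 0≤y = subst (ℚ._≤ x * y) (ℚₚ.*-zeroʳ x) (ℚₚ.*-monoˡ-≤-nonNeg x {{ℚ.nonNegative 0≤x}} 0≤y)

0<* : ∀ {x y} → 0ℚ ℚ.< x → 0ℚ ℚ.< y → 0ℚ ℚ.< x * y
0<* {x} {y} 0<x 0<y = subst (ℚ._< x * y) (ℚₚ.*-zeroʳ x) (ℚₚ.*-monoʳ-<-pos x {{ℚ.positive 0<x}} 0<y)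

quadratic>0 : ∀ c₀ c₁ c₂ c₃ c₄ c₅ {x y} → Positive c₀ →
  NonNegative c₁ → NonNegative c₂ → NonNegative c₃ → NonNegative c₄ → NonNegative c₅ →
  0ℚ ℚ.≤ x → 0ℚ ℚ.≤ y → 0ℚ ℚ.< quadratic c₀ c₁ c₂ c₃ c₄ c₅ x y
quadratic>0 c₀ c₁ c₂ c₃ c₄ c₅ p₀ p₁ p₂ p₃ p₄ p₅ 0≤x 0≤y =
  ℚₚ.+-mono-<-≤ (ℚₚ.+-mono-<-≤ (ℚₚ.+-mono-<-≤ (ℚₚ.+-mono-<-≤ (ℚₚ.+-mono-<-≤
    (ℚₚ.positive⁻¹ c₀ {{p₀}})
    (0≤* (ℚₚ.nonNegative⁻¹ c₁ {{p₁}}) 0≤x))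
    (0≤* (ℚₚ.nonNegative⁻¹ c₂ {{p₂}}) (0≤* 0≤x 0≤x)))
    (0≤* (ℚₚ.nonNegative⁻¹ c₃ {{p₃}}) 0≤y))
    (0≤* (ℚₚ.nonNegative⁻¹ c₄ {{p₄}}) (0≤* 0≤y 0≤y)))
    (0≤* (ℚₚ.nonNegative⁻¹ c₅ {{p₅}}) (0≤* 0≤x 0≤y))

-- The volume counts every edge twice, with one edge per leaf and two per leg. The energy sums
-- degree times potential: 1 · 1 per leaf, 2 · 3 + 1 · 4 per leg, and 0 at the centre.
volumeOf energyOf : ℚ → ℚ → ℚ
volumeOf a b = ι 2 * a + ι 4 * b
energyOf a b = a + ι 10 * b

-- Taylor coefficients at (p , q) of the change as a polynomial in a and b; those of b² and a b coincide.
module Coefficients (τ ε p q : ℚ) where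
  at₀ at-a at-aa at-b at-bb : ℚ
  at₀   = change (volumeOf p q) (energyOf p q) τ ε
  at-a  = τ * (ι 8 * p + ι 16 * q + ι 4) - ι 2 * ε + ι 2
  at-aa = ι 4 * τ
  at-b  = τ * (ι 16 * p + ι 32 * q + ι 8) - ι 4 * ε + ι 20
  at-bb = ι 16 * τ

-- With σ equal to 1 or -1 one argument serves increase and decrease. Only the constant coefficient
-- is strict, because the quadratic ones vanish when τ = 0. In every use the arguments are closed
-- rationals, so evaluation decides the five conditions and `_` proves them.
SignedCoefficients : ℚ → ℚ → ℚ → ℚ → ℚ → Set
SignedCoefficients σ τ ε p q =
  Positive (σ * at₀) × NonNegative (σ * at-a) × NonNegative (σ * at-aa) × NonNegative (σ * at-b) × NonNegative (σ * at-bb)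
  where open Coefficients τ ε p q

-- The displacements b1 ∸ m and b2 ∸ n from the base point are naturals, so signs of Taylor
-- coefficients there settle the sign for all larger parameters at once.
change-sign : ∀ σ τ ε m n {b1 b2} → SignedCoefficients σ τ ε (ι m) (ι n) → m ℕ.≤ b1 → n ℕ.≤ b2 →
              0ℚ ℚ.< σ * change (volumeOf (ι b1) (ι b2)) (energyOf (ι b1) (ι b2)) τ ε
change-sign σ τ ε m n {b1} {b2} (p₀ , p₁ , p₂ , p₃ , p₄) m≤b1 n≤b2 =
  subst (0ℚ ℚ.<_) eq (quadratic>0 (σ * at₀) (σ * at-a) (σ * at-aa) (σ * at-b) (σ * at-bb) (σ * at-bb)
                        p₀ p₁ p₂ p₃ p₄ p₄ (ι-≥0 (b1 ℕ.∸ m)) (ι-≥0 (b2 ℕ.∸ n)))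
  where
  open Coefficients τ ε (ι m) (ι n)
  taylor : ∀ σ τ ε p q x y →
    σ * ((ι 2 * p + ι 4 * q) * (ι 2 * p + ι 4 * q + (1ℚ + 1ℚ)) * τ - (ι 2 * p + ι 4 * q) * ε + (1ℚ + 1ℚ) * (p + ι 10 * q))
    + σ * (τ * (ι 8 * p + ι 16 * q + ι 4) - ι 2 * ε + ι 2) * x
    + σ * (ι 4 * τ) * (x * x)
    + σ * (τ * (ι 16 * p + ι 32 * q + ι 8) - ι 4 * ε + ι 20) * y
    + σ * (ι 16 * τ) * (y * y)
    + σ * (ι 16 * τ) * (x * y)
    ≡ σ * ((ι 2 * (p + x) + ι 4 * (q + y)) * (ι 2 * (p + x) + ι 4 * (q + y) + (1ℚ + 1ℚ)) * τ
           - (ι 2 * (p + x) + ι 4 * (q + y)) * ε + (1ℚ + 1ℚ) * ((p + x) + ι 10 * (q + y)))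
  taylor = solve-∀ ringℚ
  split : ∀ {k l} → k ℕ.≤ l → ι k + ι (l ℕ.∸ k) ≡ ι l
  split {k} {l} k≤l = trans (sym (ι-+ k (l ℕ.∸ k))) (cong ι (ℕₚ.m+[n∸m]≡n k≤l))
  eq = trans (taylor σ τ ε (ι m) (ι n) (ι (b1 ℕ.∸ m)) (ι (b2 ℕ.∸ n)))
         (cong₂ (λ a b → σ * change (volumeOf a b) (energyOf a b) τ ε) (split m≤b1) (split n≤b2))

-- The star-spider

data Vertex (b1 b2 : ℕ) : Set where
  centre  : Vertex b1 b2
  leaf    : Fin b1 → Vertex b1 b2
  mid end : Fin b2 → Vertex b1 b2

module StarSpider (b1 b2 : ℕ) where

  private
    V = Vertex b1 b2
    A = starSpider b1 b2

  index : V → Fin (order b1 b2)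
  index centre   = Fin.zero
  index (leaf i) = Fin.suc (i ↑ˡ 2 ℕ.* b2)
  -- `combine i k` is numbered 2 i + k, which places the two vertices of a leg next to each other;
  -- it lives in `Fin (b2 * 2)` whereas `order` contains 2 * b2, hence the cast.
  index (mid i)  = Fin.suc (b1 ↑ʳ Fin.cast (ℕₚ.*-comm b2 2) (combine i 0F))
  index (end i)  = Fin.suc (b1 ↑ʳ Fin.cast (ℕₚ.*-comm b2 2) (combine i 1F))

  legVertex : Fin b2 × Fin 2 → V
  legVertex (i , 0F) = mid i
  legVertex (i , 1F) = end i

  vertex : Fin (order b1 b2) → V
  vertex Fin.zero    = centre
  vertex (Fin.suc x) = [ leaf , (λ y → legVertex (remQuot 2 (Fin.cast (ℕₚ.*-comm 2 b2) y))) ]′ (splitAt b1 x)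

  vertex-leg : ∀ i k → vertex (Fin.suc (b1 ↑ʳ Fin.cast (ℕₚ.*-comm b2 2) (combine i k))) ≡ legVertex (i , k)
  vertex-leg i k
    rewrite Finₚ.splitAt-↑ʳ b1 (2 ℕ.* b2) (Fin.cast (ℕₚ.*-comm b2 2) (combine i k))
          | Finₚ.cast-involutive (ℕₚ.*-comm 2 b2) (ℕₚ.*-comm b2 2) (combine i k)
          | Finₚ.remQuot-combine i k = refl

  vertex-index : ∀ v → vertex (index v) ≡ v
  vertex-index centre   = refl
  vertex-index (leaf i) rewrite Finₚ.splitAt-↑ˡ b1 i (2 ℕ.* b2) = refl
  vertex-index (mid i)  = vertex-leg i 0F
  vertex-index (end i)  = vertex-leg i 1F

  index-legVertex : ∀ p → index (legVertex p) ≡ Fin.suc (b1 ↑ʳ Fin.cast (ℕₚ.*-comm b2 2) (uncurry combine p))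
  index-legVertex (i , 0F) = refl
  index-legVertex (i , 1F) = refl

  index-vertex : ∀ x → index (vertex x) ≡ x
  index-vertex Fin.zero    = refl
  index-vertex (Fin.suc x) with splitAt b1 x | Finₚ.join-splitAt b1 (2 ℕ.* b2) x
  ... | inj₁ i | eq = cong Fin.suc eq
  ... | inj₂ y | eq = begin
    index (legVertex (remQuot 2 y′))
      ≡⟨ index-legVertex (remQuot 2 y′) ⟩
    Fin.suc (b1 ↑ʳ Fin.cast (ℕₚ.*-comm b2 2) (uncurry combine (remQuot {b2} 2 y′)))
      ≡⟨ cong (λ z → Fin.suc (b1 ↑ʳ Fin.cast (ℕₚ.*-comm b2 2) z)) (Finₚ.combine-remQuot {b2} 2 y′) ⟩
    Fin.suc (b1 ↑ʳ Fin.cast (ℕₚ.*-comm b2 2) y′)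
      ≡⟨ cong (λ z → Fin.suc (b1 ↑ʳ z)) (Finₚ.cast-involutive (ℕₚ.*-comm b2 2) (ℕₚ.*-comm 2 b2) y) ⟩
    Fin.suc (b1 ↑ʳ y)
      ≡⟨ cong Fin.suc eq ⟩
    Fin.suc x ∎
    where y′ = Fin.cast (ℕₚ.*-comm 2 b2) y

  index-injective : ∀ {v w} → index v ≡ index w → v ≡ w
  index-injective {v} {w} eq = trans (sym (vertex-index v)) (trans (cong vertex eq) (vertex-index w))

  onIndices : ∀ {ℓ} (Q : Fin (order b1 b2) → Set ℓ) → (∀ v → Q (index v)) → ∀ x → Q x
  onIndices Q q x = subst Q (index-vertex x) (q (vertex x))

  ΣV : (V → ℚ) → ℚ
  ΣV f = f centre + (Σℚ (λ i → f (leaf i)) + (Σℚ (λ i → f (mid i)) + Σℚ (λ i → f (end i))))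

  Σ≡ΣV : ∀ (f : Fin (order b1 b2) → ℚ) → Σℚ f ≡ ΣV (λ v → f (index v))
  Σ≡ΣV f = cong (f Fin.zero +_) (trans (Σ-↑ b1 (f ∘ Fin.suc)) (cong (Σℚ (λ i → f (index (leaf i))) +_)
    (trans (Σ-cast (ℕₚ.*-comm b2 2) (λ y → f (Fin.suc (b1 ↑ʳ y))))
           (trans (Σ-combine₂ b2 _) (Σ-+ (λ i → f (index (mid i))) (λ i → f (index (end i))))))))

  ΣV-cong : ∀ {f g : V → ℚ} → (∀ v → f v ≡ g v) → ΣV f ≡ ΣV g
  ΣV-cong f≗g = cong₂ _+_ (f≗g centre)
    (cong₂ _+_ (Σ-cong (f≗g ∘ leaf)) (cong₂ _+_ (Σ-cong (f≗g ∘ mid)) (Σ-cong (f≗g ∘ end))))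

  label : V → ℕ
  label centre   = 0
  label (leaf i) = suc (toℕ i)
  label (mid i)  = suc (b1 ℕ.+ toℕ i ℕ.* 2)
  label (end i)  = suc (b1 ℕ.+ suc (toℕ i ℕ.* 2))

  toℕ-index : ∀ v → toℕ (index v) ≡ label v
  toℕ-index centre   = refl
  toℕ-index (leaf i) = cong suc (Finₚ.toℕ-↑ˡ i (2 ℕ.* b2))
  toℕ-index (mid i)  = cong suc (trans (Finₚ.toℕ-↑ʳ b1 _) (cong (b1 ℕ.+_) (trans (Finₚ.toℕ-cast _ (combine i 0F))
    (trans (Finₚ.toℕ-combine i 0F) (trans (ℕₚ.+-identityʳ _) (ℕₚ.*-comm 2 (toℕ i)))))))
  toℕ-index (end i)  = cong suc (trans (Finₚ.toℕ-↑ʳ b1 _) (cong (b1 ℕ.+_) (trans (Finₚ.toℕ-cast _ (combine i 1F))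
    (trans (Finₚ.toℕ-combine i 1F) (trans (ℕₚ.+-comm _ 1) (cong suc (ℕₚ.*-comm 2 (toℕ i))))))))

  leafᵇ midᵇ : V → Bool
  leafᵇ (leaf _) = true
  leafᵇ _        = false
  midᵇ (mid _) = true
  midᵇ _       = false

  endOfᵇ : Fin b2 → V → Bool
  endOfᵇ i (end j) = does (j Fin.≟ i)
  endOfᵇ i _       = false

  -- Edges point away from the centre, matching `adjLt` clause by clause; `starSpider-index`
  -- symmetrises.
  edgeᵇ : V → V → Bool
  edgeᵇ centre  w = leafᵇ w ∨ midᵇ w
  edgeᵇ (mid i) w = endOfᵇ i w
  edgeᵇ _       w = false

  label-leafᵇ : ∀ v → ((1 ≤ᵇ label v) ∧ (label v ≤ᵇ b1)) ≡ leafᵇ v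
  label-leafᵇ centre   = refl
  label-leafᵇ (leaf i) = dec-true (label (leaf i) ℕ.≤? b1) (Finₚ.toℕ<n i)
  label-leafᵇ (mid i)  = dec-false (label (mid i) ℕ.≤? b1) (ℕₚ.m+n≮m b1 _)
  label-leafᵇ (end i)  = dec-false (label (end i) ℕ.≤? b1) (ℕₚ.m+n≮m b1 _)

  label-midᵇ : ∀ v → isMid b1 (label v) ≡ midᵇ v
  label-midᵇ centre   = refl
  -- Truncated subtraction gives 0 at a leaf, so the parity test alone would accept it; the lower
  -- bound on the label rejects it.
  label-midᵇ (leaf i) = cong (_∧ ((toℕ i ℕ.∸ b1) % 2 ≡ᵇ 0)) (dec-false (suc b1 ℕ.≤? label (leaf i)) (λ b1<i → ℕₚ.<⇒≱ (Finₚ.toℕ<n i) (ℕ.s≤s⁻¹ b1<i)))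
  label-midᵇ (mid i)  = cong₂ _∧_ (dec-true (suc b1 ℕ.≤? label (mid i)) (ℕ.s≤s (ℕₚ.m≤m+n b1 _)))
    (cong (_≡ᵇ 0) (trans (cong (_% 2) (ℕₚ.m+n∸m≡n b1 _)) ([m+kn]%n≡m%n 0 (toℕ i) 2)))
  label-midᵇ (end i)  = cong₂ _∧_ (dec-true (suc b1 ℕ.≤? label (end i)) (ℕ.s≤s (ℕₚ.m≤m+n b1 _)))
    (cong (_≡ᵇ 0) (trans (cong (_% 2) (ℕₚ.m+n∸m≡n b1 _)) ([m+kn]%n≡m%n 1 (toℕ i) 2)))

  label-endOfᵇ : ∀ i v → (label v ≡ᵇ suc (label (mid i))) ≡ endOfᵇ i v
  label-endOfᵇ i centre   = refl
  label-endOfᵇ i (leaf j) = dec-false (label (leaf j) ℕ.≟ suc (label (mid i)))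
    (λ eq → ℕₚ.<⇒≱ (Finₚ.toℕ<n j) (ℕₚ.≤-trans (ℕₚ.m≤m+n b1 _) (ℕₚ.≤-trans (ℕₚ.n≤1+n _) (ℕₚ.≤-reflexive (sym (ℕₚ.suc-injective eq))))))
  -- Labels of middle vertices all have the same parity, so no two of them are consecutive.
  label-endOfᵇ i (mid j)  = dec-false (label (mid j) ℕ.≟ suc (label (mid i)))
    (λ eq → even≢odd (toℕ j) (toℕ i) (ℕₚ.+-cancelˡ-≡ b1 _ _ (trans (ℕₚ.suc-injective eq) (sym (ℕₚ.+-suc b1 _)))))
    where
    even≢odd : ∀ m n → m ℕ.* 2 ≡ suc (n ℕ.* 2) → ⊥
    even≢odd m n eq = case trans (sym ([m+kn]%n≡m%n 0 m 2)) (trans (cong (_% 2) eq) ([m+kn]%n≡m%n 1 n 2)) of λ ()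
  label-endOfᵇ i (end j) with j Fin.≟ i
  ... | yes refl = dec-true (label (end j) ℕ.≟ suc (label (mid j))) (cong suc (ℕₚ.+-suc b1 _))
  ... | no j≢i   = dec-false (label (end j) ℕ.≟ suc (label (mid i)))
    (λ eq → j≢i (Finₚ.toℕ-injective (ℕₚ.*-cancelʳ-≡ _ _ 2 (ℕₚ.suc-injective (ℕₚ.+-cancelˡ-≡ b1 _ _ (trans (ℕₚ.suc-injective eq) (sym (ℕₚ.+-suc b1 _))))))))

  adjLt-label : ∀ v w → adjLt b1 (label v) (label w) ≡ edgeᵇ v w
  adjLt-label centre w = cong₂ _∨_ (label-leafᵇ w) (trans (∨-identityʳ _) (label-midᵇ w))
  adjLt-label v@(leaf _) w = cong (_∧ (label w ≡ᵇ suc (label v))) (label-midᵇ v)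
  adjLt-label v@(end _)  w = cong (_∧ (label w ≡ᵇ suc (label v))) (label-midᵇ v)
  adjLt-label v@(mid i)  w = cong₂ _∧_ (label-midᵇ v) (label-endOfᵇ i w)

  starSpider-index : ∀ v w → A (index v) (index w) ≡ edgeᵇ v w ∨ edgeᵇ w v
  starSpider-index v w rewrite toℕ-index v | toℕ-index w = cong₂ _∨_ (adjLt-label v w) (adjLt-label w v)

  neighbourSum : V → (V → ℚ) → ℚ
  neighbourSum centre   f = Σℚ (λ i → f (leaf i)) + Σℚ (λ i → f (mid i))
  neighbourSum (leaf i) f = f centre
  neighbourSum (mid i)  f = f centre + f (end i)
  neighbourSum (end i)  f = f (mid i)

  Σ-edge : ∀ v f → ΣV (λ k → ι (b2n (edgeᵇ v k ∨ edgeᵇ k v)) * f k) ≡ neighbourSum v f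
  Σ-edge centre f = trans
    (cong₂ _+_ (ℚₚ.*-zeroˡ (f centre)) (cong₂ _+_ (Σ-cong (λ i → ℚₚ.*-identityˡ (f (leaf i))))
      (cong₂ _+_ (Σ-cong (λ i → ℚₚ.*-identityˡ (f (mid i)))) (Σ-0* (f ∘ end)))))
    (simplify (Σℚ (f ∘ leaf)) (Σℚ (f ∘ mid)))
    where
    simplify : ∀ x y → 0ℚ + (x + (y + 0ℚ)) ≡ x + y
    simplify = solve-∀ ringℚ
  Σ-edge (leaf i) f = trans
    (cong₂ _+_ (ℚₚ.*-identityˡ (f centre)) (cong₂ _+_ (Σ-0* (f ∘ leaf)) (cong₂ _+_ (Σ-0* (f ∘ mid)) (Σ-0* (f ∘ end)))))
    (ℚₚ.+-identityʳ (f centre))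
  Σ-edge (mid i) f = trans
    (cong₂ _+_ (ℚₚ.*-identityˡ (f centre)) (cong₂ _+_ (Σ-0* (f ∘ leaf)) (cong₂ _+_ (Σ-0* (f ∘ mid))
      (trans (Σ-cong (λ k → cong (_* f (end k)) (trans (cong (ι ∘ b2n) (∨-identityʳ (does (k Fin.≟ i)))) (ι-b2n (does (k Fin.≟ i))))))
             (Σ-δ i (f ∘ end))))))
    (simplify (f centre) (f (end i)))
    where
    simplify : ∀ x y → x + (0ℚ + (0ℚ + y)) ≡ x + y
    simplify = solve-∀ ringℚ
  Σ-edge (end i) f = trans
    (cong₂ _+_ (ℚₚ.*-zeroˡ (f centre)) (cong₂ _+_ (Σ-0* (f ∘ leaf)) (cong₂ _+_
      (trans (Σ-cong (λ k → cong (_* f (mid k)) (trans (ι-b2n (does (i Fin.≟ k))) (δ-sym i k)))) (Σ-δ i (f ∘ mid)))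
      (Σ-0* (f ∘ end)))))
    (simplify (f (mid i)))
    where
    simplify : ∀ x → 0ℚ + (0ℚ + (x + 0ℚ)) ≡ x
    simplify = solve-∀ ringℚ

  Σ-weight-index : ∀ v (f : Fin (order b1 b2) → ℚ) → Σℚ (λ k → weight A (index v) k * f k) ≡ neighbourSum v (f ∘ index)
  Σ-weight-index v f = trans (Σ≡ΣV (λ k → weight A (index v) k * f k))
    (trans (ΣV-cong (λ k → cong (λ e → ι (b2n e) * f (index k)) (starSpider-index v k))) (Σ-edge v (f ∘ index)))

  degreeV : V → ℚ
  degreeV v = neighbourSum v (λ _ → 1ℚ)

  degree-index : ∀ v → degree A (index v) ≡ degreeV v
  degree-index v = trans (Σ-cong (λ k → sym (ℚₚ.*-identityʳ (weight A (index v) k)))) (Σ-weight-index v (λ _ → 1ℚ))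

  -- The entry at v, w is the number of edges shared by the paths from the centre to v and to w.
  greenV : V → V → ℚ
  greenV (leaf i) (leaf j) = δ j i
  greenV (mid i)  (mid j)  = δ j i
  greenV (mid i)  (end j)  = δ j i
  greenV (end i)  (mid j)  = δ j i
  greenV (end i)  (end j)  = 2ℚ * δ j i
  greenV _        _        = 0ℚ

  green : Fin (order b1 b2) → Fin (order b1 b2) → ℚ
  green x y = greenV (vertex x) (vertex y)

  green-index : ∀ v w → green (index v) (index w) ≡ greenV v w
  green-index v w = cong₂ greenV (vertex-index v) (vertex-index w)

  greenV-sym : ∀ v w → greenV v w ≡ greenV w v
  greenV-sym centre   centre   = refl
  greenV-sym centre   (leaf j) = refl
  greenV-sym centre   (mid j)  = refl
  greenV-sym centre   (end j)  = refl
  greenV-sym (leaf i) centre   = refl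
  greenV-sym (leaf i) (leaf j) = δ-sym j i
  greenV-sym (leaf i) (mid j)  = refl
  greenV-sym (leaf i) (end j)  = refl
  greenV-sym (mid i)  centre   = refl
  greenV-sym (mid i)  (leaf j) = refl
  greenV-sym (mid i)  (mid j)  = δ-sym j i
  greenV-sym (mid i)  (end j)  = δ-sym j i
  greenV-sym (end i)  centre   = refl
  greenV-sym (end i)  (leaf j) = refl
  greenV-sym (end i)  (mid j)  = δ-sym j i
  greenV-sym (end i)  (end j)  = cong (2ℚ *_) (δ-sym j i)

  -- Row `v` of the Green matrix applied to `f`: only the branch containing `v` contributes, and
  -- `f centre` never occurs.
  greenSum : V → (V → ℚ) → ℚ
  greenSum centre   f = 0ℚ
  greenSum (leaf i) f = f (leaf i)
  greenSum (mid i)  f = f (mid i) + f (end i)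
  greenSum (end i)  f = f (mid i) + 2ℚ * f (end i)

  Σ-greenV : ∀ v f → ΣV (λ k → greenV v k * f k) ≡ greenSum v f
  Σ-greenV centre f =
    cong₂ _+_ (ℚₚ.*-zeroˡ (f centre)) (cong₂ _+_ (Σ-0* (f ∘ leaf)) (cong₂ _+_ (Σ-0* (f ∘ mid)) (Σ-0* (f ∘ end))))
  Σ-greenV (leaf i) f = trans
    (cong₂ _+_ (ℚₚ.*-zeroˡ (f centre)) (cong₂ _+_ (Σ-δ i (f ∘ leaf)) (cong₂ _+_ (Σ-0* (f ∘ mid)) (Σ-0* (f ∘ end)))))
    (simplify (f (leaf i)))
    where
    simplify : ∀ x → 0ℚ + (x + (0ℚ + 0ℚ)) ≡ x
    simplify = solve-∀ ringℚ
  Σ-greenV (mid i) f = trans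
    (cong₂ _+_ (ℚₚ.*-zeroˡ (f centre)) (cong₂ _+_ (Σ-0* (f ∘ leaf)) (cong₂ _+_ (Σ-δ i (f ∘ mid)) (Σ-δ i (f ∘ end)))))
    (simplify (f (mid i)) (f (end i)))
    where
    simplify : ∀ x y → 0ℚ + (0ℚ + (x + y)) ≡ x + y
    simplify = solve-∀ ringℚ
  Σ-greenV (end i) f = trans
    (cong₂ _+_ (ℚₚ.*-zeroˡ (f centre)) (cong₂ _+_ (Σ-0* (f ∘ leaf)) (cong₂ _+_ (Σ-δ i (f ∘ mid))
      (trans (Σ-cong (λ k → ℚₚ.*-assoc 2ℚ (δ k i) (f (end k)))) (trans (Σ-*ˡ 2ℚ (λ k → δ k i * f (end k))) (cong (2ℚ *_) (Σ-δ i (f ∘ end))))))))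
    (simplify (f (mid i)) (2ℚ * f (end i)))
    where
    simplify : ∀ x y → 0ℚ + (0ℚ + (x + y)) ≡ x + y
    simplify = solve-∀ ringℚ

  δV : V → V → ℚ
  δV centre   centre   = 1ℚ
  δV (leaf i) (leaf j) = δ i j
  δV (mid i)  (mid j)  = δ i j
  δV (end i)  (end j)  = δ i j
  δV _        _        = 0ℚ

  δ-index-≢ : ∀ {v w} → v ≢ w → δ (index v) (index w) ≡ 0ℚ
  δ-index-≢ v≢w = δ-≢ (v≢w ∘ index-injective)

  δ-index∘ : ∀ {n} (h : Fin n → V) → (∀ {i j} → h i ≡ h j → i ≡ j) → ∀ i j → δ (index (h i)) (index (h j)) ≡ δ i j
  δ-index∘ h inj = δ-injective {h = index ∘ h} (λ {i} {j} eq → inj (index-injective {h i} {h j} eq))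

  δ-index : ∀ v w → δ (index v) (index w) ≡ δV v w
  δ-index centre   centre   = refl
  δ-index centre   (leaf j) = refl
  δ-index centre   (mid j)  = refl
  δ-index centre   (end j)  = refl
  δ-index (leaf i) centre   = refl
  δ-index (leaf i) (leaf j) = δ-index∘ leaf (λ { refl → refl }) i j
  δ-index (leaf i) (mid j)  = δ-index-≢ {leaf i} {mid j} λ ()
  δ-index (leaf i) (end j)  = δ-index-≢ {leaf i} {end j} λ ()
  δ-index (mid i)  centre   = refl
  δ-index (mid i)  (leaf j) = δ-index-≢ {mid i} {leaf j} λ ()
  δ-index (mid i)  (mid j)  = δ-index∘ mid (λ { refl → refl }) i j
  δ-index (mid i)  (end j)  = δ-index-≢ {mid i} {end j} λ ()
  δ-index (end i)  centre   = refl
  δ-index (end i)  (leaf j) = δ-index-≢ {end i} {leaf j} λ ()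
  δ-index (end i)  (mid j)  = δ-index-≢ {end i} {mid j} λ ()
  δ-index (end i)  (end j)  = δ-index∘ end (λ { refl → refl }) i j

  -- Column `w` rises by one along each edge of the path from the centre to `w` and is constant
  -- across all other edges. It is the potential of a unit flow with source `w` and sink at the
  -- centre, so its Laplacian vanishes everywhere else.
  laplacian-greenV : ∀ w v → degreeV v * greenV v w - neighbourSum v (λ k → greenV k w) ≡ δV v w - δV v centre
  laplacian-greenV w centre = trans (simplify (degreeV centre) (neighbourSum centre (λ k → greenV k w))) (column w)
    where
    simplify : ∀ d x → d * 0ℚ - x ≡ - x
    simplify = solve-∀ ringℚ
    column : ∀ w → - neighbourSum centre (λ k → greenV k w) ≡ δV centre w - 1ℚ
    column centre   = cong -_ (cong₂ _+_ (Σ-0 b1) (Σ-0 b2))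
    column (leaf j) = cong -_ (cong₂ _+_ (Σ-δ≡1 j) (Σ-0 b2))
    column (mid j)  = cong -_ (cong₂ _+_ (Σ-0 b1) (Σ-δ≡1 j))
    column (end j)  = cong -_ (cong₂ _+_ (Σ-0 b1) (Σ-δ≡1 j))
  laplacian-greenV centre   (leaf i) = refl
  laplacian-greenV (leaf j) (leaf i) = trans (simplify (δ j i)) (cong (_- 0ℚ) (δ-sym j i))
    where
    simplify : ∀ x → 1ℚ * x - 0ℚ ≡ x - 0ℚ
    simplify = solve-∀ ringℚ
  laplacian-greenV (mid j)  (leaf i) = refl
  laplacian-greenV (end j)  (leaf i) = refl
  laplacian-greenV centre   (mid i)  = refl
  laplacian-greenV (leaf j) (mid i)  = refl
  laplacian-greenV (mid j)  (mid i)  = trans (simplify (δ j i)) (cong (_- 0ℚ) (δ-sym j i))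
    where
    simplify : ∀ x → (1ℚ + 1ℚ) * x - (0ℚ + x) ≡ x - 0ℚ
    simplify = solve-∀ ringℚ
  laplacian-greenV (end j)  (mid i)  = simplify (δ j i)
    where
    simplify : ∀ x → (1ℚ + 1ℚ) * x - (0ℚ + (1ℚ + 1ℚ) * x) ≡ 0ℚ
    simplify = solve-∀ ringℚ
  laplacian-greenV centre   (end i)  = refl
  laplacian-greenV (leaf j) (end i)  = refl
  laplacian-greenV (mid j)  (end i)  = simplify (δ j i)
    where
    simplify : ∀ x → 1ℚ * x - x ≡ 0ℚ
    simplify = solve-∀ ringℚ
  laplacian-greenV (end j)  (end i)  = trans (simplify (δ j i)) (cong (_- 0ℚ) (δ-sym j i))
    where
    simplify : ∀ x → 1ℚ * ((1ℚ + 1ℚ) * x) - x ≡ x - 0ℚ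
    simplify = solve-∀ ringℚ

  starSpider-sym : ∀ x y → A x y ≡ A y x
  starSpider-sym x y = ∨-comm (adjLt b1 (toℕ x) (toℕ y)) (adjLt b1 (toℕ y) (toℕ x))

  green-sym : ∀ x y → green x y ≡ green y x
  green-sym x y = greenV-sym (vertex x) (vertex y)

  laplacian-green : ∀ w v → laplacian A (λ k → green k (index w)) (index v) ≡ δ (index v) (index w) - δ (index v) Fin.zero
  laplacian-green w v = begin
    degree A (index v) * green (index v) (index w) - Σℚ (λ k → weight A (index v) k * green k (index w))
      ≡⟨ cong₂ _-_ (cong₂ _*_ (degree-index v) (green-index v w)) (trans (Σ≡ΣV (λ k → weight A (index v) k * green k (index w)))
           (ΣV-cong (λ k → cong₂ _*_ (cong (ι ∘ b2n) (starSpider-index v k)) (green-index k w)))) ⟩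
    degreeV v * greenV v w - ΣV (λ k → ι (b2n (edgeᵇ v k ∨ edgeᵇ k v)) * greenV k w)
      ≡⟨ cong (λ t → degreeV v * greenV v w - t) (Σ-edge v (λ k → greenV k w)) ⟩
    degreeV v * greenV v w - neighbourSum v (λ k → greenV k w)
      ≡⟨ laplacian-greenV w v ⟩
    δV v w - δV v centre
      ≡⟨ cong₂ _-_ (δ-index v w) (δ-index v centre) ⟨
    δ (index v) (index w) - δ (index v) Fin.zero ∎

  volume-starSpider : volume A ≡ ι 2 * ι b1 + ι 4 * ι b2
  volume-starSpider = begin
    Σℚ (degree A)
      ≡⟨ trans (Σ≡ΣV (degree A)) (ΣV-cong degree-index) ⟩
    (Σℚ {b1} (λ _ → 1ℚ) + Σℚ {b2} (λ _ → 1ℚ)) + (Σℚ {b1} (λ _ → 1ℚ) + (Σℚ {b2} (λ _ → 2ℚ) + Σℚ {b2} (λ _ → 1ℚ)))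
      ≡⟨ cong₂ _+_ (cong₂ _+_ (Σ-const b1 1ℚ) (Σ-const b2 1ℚ)) (cong₂ _+_ (Σ-const b1 1ℚ) (cong₂ _+_ (Σ-const b2 2ℚ) (Σ-const b2 1ℚ))) ⟩
    (ι b1 * 1ℚ + ι b2 * 1ℚ) + (ι b1 * 1ℚ + (ι b2 * 2ℚ + ι b2 * 1ℚ))
      ≡⟨ simplify (ι b1) (ι b2) ⟩
    ι 2 * ι b1 + ι 4 * ι b2 ∎
    where
    simplify : ∀ x y → (x * 1ℚ + y * 1ℚ) + (x * 1ℚ + (y * 2ℚ + y * 1ℚ)) ≡ ι 2 * x + ι 4 * y
    simplify = solve-∀ ringℚ

  potential-index : ∀ v → potential A green (index v) ≡ greenSum v degreeV
  potential-index v = trans (Σ≡ΣV (λ k → green (index v) k * degree A k))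
    (trans (ΣV-cong (λ k → cong₂ _*_ (green-index v k) (degree-index k))) (Σ-greenV v degreeV))

  energy-starSpider : energy A green ≡ ι b1 + ι 10 * ι b2
  energy-starSpider = begin
    Σℚ (λ x → degree A x * potential A green x)
      ≡⟨ trans (Σ≡ΣV (λ x → degree A x * potential A green x)) (ΣV-cong (λ v → cong₂ _*_ (degree-index v) (potential-index v))) ⟩
    degreeV centre * 0ℚ + (Σℚ {b1} (λ _ → 1ℚ) + (Σℚ {b2} (λ _ → ι 6) + Σℚ {b2} (λ _ → ι 4)))
      ≡⟨ cong (_+_ (degreeV centre * 0ℚ)) (cong₂ _+_ (Σ-const b1 1ℚ) (cong₂ _+_ (Σ-const b2 (ι 6)) (Σ-const b2 (ι 4)))) ⟩
    degreeV centre * 0ℚ + (ι b1 * 1ℚ + (ι b2 * ι 6 + ι b2 * ι 4))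
      ≡⟨ simplify (degreeV centre) (ι b1) (ι b2) ⟩
    ι b1 + ι 10 * ι b2 ∎
    where
    simplify : ∀ d x y → d * 0ℚ + (x * 1ℚ + (y * ι 6 + y * ι 4)) ≡ x + ι 10 * y
    simplify = solve-∀ ringℚ

  gram-index : ∀ v w → Σℚ (λ k → degree A k * (green k (index v) * green k (index w))) ≡ greenSum v (λ k → degreeV k * greenV k w)
  gram-index v w = begin
    Σℚ (λ k → degree A k * (green k (index v) * green k (index w)))
      ≡⟨ Σ≡ΣV (λ k → degree A k * (green k (index v) * green k (index w))) ⟩
    ΣV (λ k → degree A (index k) * (green (index k) (index v) * green (index k) (index w)))
      ≡⟨ ΣV-cong (λ k → trans (cong₂ _*_ (degree-index k) (cong₂ _*_ (trans (green-index k v) (greenV-sym k v)) (green-index k w)))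
                              (rotate (degreeV k) (greenV v k) (greenV k w))) ⟩
    ΣV (λ k → greenV v k * (degreeV k * greenV k w))
      ≡⟨ Σ-greenV v (λ k → degreeV k * greenV k w) ⟩
    greenSum v (λ k → degreeV k * greenV k w) ∎
    where
    rotate : ∀ d x y → d * (x * y) ≡ x * (d * y)
    rotate = solve-∀ ringℚ

  degreeV>0 : 1 ℕ.≤ b1 → ∀ v → 0ℚ ℚ.< degreeV v
  degreeV>0 1≤b1 centre   = subst (0ℚ ℚ.<_) (sym (cong₂ _+_ (count b1) (count b2))) (ℚₚ.+-mono-<-≤ (ι>0 1≤b1) (ι-≥0 b2))
    where
    count : ∀ n → Σℚ {n} (λ _ → 1ℚ) ≡ ι n
    count n = trans (Σ-const n 1ℚ) (ℚₚ.*-identityʳ (ι n))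
  degreeV>0 _ (leaf i) = ℚₚ.positive⁻¹ 1ℚ
  degreeV>0 _ (mid i)  = ℚₚ.positive⁻¹ 2ℚ
  degreeV>0 _ (end i)  = ℚₚ.positive⁻¹ 1ℚ

  starSpider-isGreen : 1 ℕ.≤ b1 → IsGreen A Fin.zero green
  starSpider-isGreen 1≤b1 = record
    { A-sym    = starSpider-sym
    ; degree>0 = onIndices (λ x → 0ℚ ℚ.< degree A x) (λ v → subst (0ℚ ℚ.<_) (sym (degree-index v)) (degreeV>0 1≤b1 v))
    ; G-sym    = green-sym
    ; LG≡δ     = onIndices (λ y → ∀ x → laplacian A (λ k → green k y) x ≡ δ x y - δ x Fin.zero)
                   (λ w → onIndices (λ x → laplacian A (λ k → green k (index w)) x ≡ δ x (index w) - δ x Fin.zero) (laplacian-green w))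
    }

-- Distinct indices and the number of increasing pairs

≢⇒2≤ : ∀ {n} {i j : Fin n} → i ≢ j → 2 ℕ.≤ n
≢⇒2≤ {suc zero}    {Fin.zero} {Fin.zero} i≢j = contradiction refl i≢j
≢⇒2≤ {suc (suc n)} _ = ℕ.s≤s (ℕ.s≤s ℕ.z≤n)

increasingPairs : ∀ n → List (Fin n × Fin n)
increasingPairs zero    = []
increasingPairs (suc n) = map (λ j → Fin.zero , Fin.suc j) (allFin n) ++ map (map× Fin.suc Fin.suc) (increasingPairs n)

-- Pascal's rule: the pairs starting with 0 number n = n C 1, and the others are the shifted pairs
-- of the smaller set.
length-increasingPairs : ∀ n → length (increasingPairs n) ≡ n C 2
length-increasingPairs zero    = refl
length-increasingPairs (suc n) = begin
  length (map (λ j → Fin.zero , Fin.suc j) (allFin n) ++ map (map× Fin.suc Fin.suc) (increasingPairs n))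
    ≡⟨ length-++ (map (λ j → Fin.zero , Fin.suc j) (allFin n)) ⟩
  length (map (λ j → Fin.zero {n} , Fin.suc j) (allFin n)) ℕ.+ length (map (map× Fin.suc Fin.suc) (increasingPairs n))
    ≡⟨ cong₂ ℕ._+_ (trans (length-map _ (allFin n)) (length-tabulate _)) (trans (length-map _ (increasingPairs n)) (length-increasingPairs n)) ⟩
  n ℕ.+ n C 2
    ≡⟨ cong (ℕ._+ n C 2) (nC1≡n n) ⟨
  n C 1 ℕ.+ n C 2
    ≡⟨ nCk+nC[k+1]≡[n+1]C[k+1] n 1 ⟩
  suc n C 2 ∎

∈-increasingPairs⁺ : ∀ {n} {i j : Fin n} → i Fin.< j → (i , j) ∈ increasingPairs n
∈-increasingPairs⁺ {suc n} {Fin.zero}  {Fin.suc j} _   = ∈-++⁺ˡ (∈-map⁺ _ (∈-allFin j))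
∈-increasingPairs⁺ {suc n} {Fin.suc i} {Fin.suc j} i<j =
  ∈-++⁺ʳ (map _ (allFin n)) (∈-map⁺ _ (∈-increasingPairs⁺ (ℕ.s≤s⁻¹ i<j)))

∈-increasingPairs⁻ : ∀ {n} {i j : Fin n} → (i , j) ∈ increasingPairs n → i Fin.< j
∈-increasingPairs⁻ {suc n} ij∈ with ∈-++⁻ (map (λ j → Fin.zero , Fin.suc j) (allFin n)) ij∈
... | inj₁ ij∈ˡ with _ , _ , refl ← ∈-map⁻ _ ij∈ˡ = ℕ.s≤s ℕ.z≤n
... | inj₂ ij∈ʳ with _ , ij∈′ , refl ← ∈-map⁻ _ ij∈ʳ = ℕ.s≤s (∈-increasingPairs⁻ ij∈′)

increasingPairs-unique : ∀ n → Unique (increasingPairs n)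
increasingPairs-unique zero    = []
increasingPairs-unique (suc n) = Uniqueₚ.++⁺
  (Uniqueₚ.map⁺ (λ { refl → refl }) (Uniqueₚ.allFin⁺ n))
  (Uniqueₚ.map⁺ (λ { refl → refl }) (increasingPairs-unique n))
  λ { (∈ˡ , ∈ʳ) → case ∈-map⁻ _ ∈ˡ , ∈-map⁻ _ ∈ʳ of λ { ((_ , _ , refl) , (_ , _ , ())) } }

-- Braess edges of the star-spider

module Braess (b1 b2 : ℕ) (1≤b1 : 1 ℕ.≤ b1) (1≤b2 : 1 ℕ.≤ b2) where

  open StarSpider b1 b2

  private
    V = Vertex b1 b2
    A = starSpider b1 b2
    isGreen₀ = starSpider-isGreen 1≤b1
    a = ι b1
    b = ι b2

  -- The diagonal of G (the distance to the centre), the vector G d, and the diagonal of G diag(d)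
  -- G. For example, the load of an end is 2 · 1 + 1 · 2 and its inertia 2 · 1² + 1 · 2², from the
  -- degrees 2 and 1 on its leg.
  height load inertia : V → ℚ
  height centre   = 0ℚ
  height (leaf _) = ι 1
  height (mid _)  = ι 1
  height (end _)  = ι 2
  load centre   = 0ℚ
  load (leaf _) = ι 1
  load (mid _)  = ι 3
  load (end _)  = ι 4
  inertia centre   = 0ℚ
  inertia (leaf _) = ι 1
  inertia (mid _)  = ι 3
  inertia (end _)  = ι 6

  greenV-diag : ∀ v → greenV v v ≡ height v
  greenV-diag centre   = refl
  greenV-diag (leaf i) = δ-refl i
  greenV-diag (mid i)  = δ-refl i
  greenV-diag (end i)  = cong (2ℚ *_) (δ-refl i)

  potential-load : ∀ v → greenSum v degreeV ≡ load v
  potential-load centre   = refl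
  potential-load (leaf i) = refl
  potential-load (mid i)  = refl
  potential-load (end i)  = refl

  gramV : V → V → ℚ
  gramV v w = greenSum v (λ k → degreeV k * greenV k w)

  gramV-diag : ∀ v → gramV v v ≡ inertia v
  gramV-diag centre   = refl
  gramV-diag (leaf i) = cong (1ℚ *_) (δ-refl i)
  gramV-diag (mid i)  = cong (λ t → 2ℚ * t + 1ℚ * t) (δ-refl i)
  gramV-diag (end i)  = cong (λ t → 2ℚ * t + 2ℚ * (1ℚ * (2ℚ * t))) (δ-refl i)

  -- These are `trace-addEdge` and `energy-addEdge` with zero mixed entries; the dipole is then
  -- `height v` at `v` and minus `height w` at `w`.
  traceGain energyGain : ℚ → V → V → ℚ
  traceGain r v w = height v + height w - r * (height v * height v + height w * height w + (inertia v + inertia w))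
  energyGain r v w = 2ℚ * (load v + load w) + (height v + height w)
                     - r * ((load v - load w + (height v - height w)) * (load v - load w + (height v - height w)))

  -- The hypotheses `green≡0` and `gram≡0` say that the branches do not interact. They hold when `v`
  -- and `w` lie on different branches, and also for the centre and an end because the row of the
  -- centre is zero. The resistance between `v` and `w` is then `height v + height w`.
  module _ {v w : V} (v≢w : index v ≢ index w) (vw∉A : A (index v) (index w) ≡ false)
           (green≡0 : greenV v w ≡ 0ℚ) (gram≡0 : gramV v w ≡ 0ℚ)
           (r : ℚ) (r-inv : r * (1ℚ + (height v + height w)) ≡ 1ℚ) where
    open AddEdge isGreen₀ v≢w vw∉A

    green-vv : green (index v) (index v) ≡ height v
    green-vv = trans (green-index v v) (greenV-diag v)

    green-ww : green (index w) (index w) ≡ height w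
    green-ww = trans (green-index w w) (greenV-diag w)

    green-vw : green (index v) (index w) ≡ 0ℚ
    green-vw = trans (green-index v w) green≡0

    dipole-v : dipole (index v) ≡ height v - 0ℚ
    dipole-v = cong₂ _-_ green-vv green-vw

    dipole-w : dipole (index w) ≡ 0ℚ - height w
    dipole-w = cong₂ _-_ (trans (green-sym (index w) (index v)) green-vw) green-ww

    w-inv : r * (1ℚ + (dipole (index v) - dipole (index w))) ≡ 1ℚ
    w-inv = trans (cong (λ t → r * (1ℚ + t)) (trans (cong₂ _-_ dipole-v dipole-w) (simplify (height v) (height w)))) r-inv
      where
      simplify : ∀ x y → (x - 0ℚ) - (0ℚ - y) ≡ x + y
      simplify = solve-∀ ringℚ

    open Update r w-inv public

    trace-gain : trace A′ G′ ≡ trace A green + traceGain r v w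
    trace-gain = begin
      trace A′ G′
        ≡⟨ trace-addEdge ⟩
      T - r * (gram (index v) (index v) + gram (index w) (index w) - 2ℚ * gram (index v) (index w)) + (G′ (index v) (index v) + G′ (index w) (index w))
        ≡⟨ cong₂ (λ x y → T - r * x + y)
             (cong₂ _-_ (cong₂ _+_ (trans (gram-index v v) (gramV-diag v)) (trans (gram-index w w) (gramV-diag w)))
                        (cong (2ℚ *_) (trans (gram-index v w) gram≡0)))
             (cong₂ _+_ (cong₂ (λ x y → x - r * (y * y)) green-vv dipole-v) (cong₂ (λ x y → x - r * (y * y)) green-ww dipole-w)) ⟩
      T - r * (inertia v + inertia w - 2ℚ * 0ℚ)
        + ((height v - r * ((height v - 0ℚ) * (height v - 0ℚ))) + (height w - r * ((0ℚ - height w) * (0ℚ - height w))))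
        ≡⟨ collect T r (inertia v) (inertia w) (height v) (height w) ⟩
      T + traceGain r v w ∎
      where
      T = trace A green
      collect : ∀ T r i j x y → T - r * (i + j - 2ℚ * 0ℚ) + ((x - r * ((x - 0ℚ) * (x - 0ℚ))) + (y - r * ((0ℚ - y) * (0ℚ - y))))
                ≡ T + (x + y - r * (x * x + y * y + (i + j)))
      collect = solve-∀ ringℚ

    energy-gain : energy A′ G′ ≡ energy A green + energyGain r v w
    energy-gain = begin
      energy A′ G′
        ≡⟨ energy-addEdge ⟩
      q + 2ℚ * (s (index v) + s (index w)) + (green (index v) (index v) + green (index w) (index w) + 2ℚ * green (index v) (index w)) - r * (x * x)
        ≡⟨ cong₂ _-_ (cong₂ _+_ (cong₂ (λ x y → q + 2ℚ * (x + y)) (s≡ v) (s≡ w)) (cong₂ _+_ (cong₂ _+_ green-vv green-ww) (cong (2ℚ *_) green-vw)))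
                     (cong (λ t → r * (t * t)) (cong₂ _+_ (cong₂ _-_ (s≡ v) (s≡ w)) (cong₂ _+_ dipole-v dipole-w))) ⟩
      q + 2ℚ * (load v + load w) + (height v + height w + 2ℚ * 0ℚ)
        - r * ((load v - load w + ((height v - 0ℚ) + (0ℚ - height w))) * (load v - load w + ((height v - 0ℚ) + (0ℚ - height w))))
        ≡⟨ collect q (load v) (load w) (height v) (height w) r ⟩
      q + energyGain r v w ∎
      where
      q = energy A green
      s = potential A green
      x = s (index v) - s (index w) + (dipole (index v) + dipole (index w))
      s≡ : ∀ v → s (index v) ≡ load v
      s≡ v = trans (potential-index v) (potential-load v)
      collect : ∀ q l m x y r →
        q + 2ℚ * (l + m) + (x + y + 2ℚ * 0ℚ) - r * ((l - m + ((x - 0ℚ) + (0ℚ - y))) * (l - m + ((x - 0ℚ) + (0ℚ - y))))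
        ≡ q + (2ℚ * (l + m) + (x + y) - r * ((l - m + (x - y)) * (l - m + (x - y))))
      collect = solve-∀ ringℚ

    kemeny-starSpider-change : ∀ {κ κ′} → IsKemeny A κ → IsKemeny A′ κ′ →
      volumeOf a b * (volumeOf a b + 2ℚ) * (κ′ - κ) ≡ change (volumeOf a b) (energyOf a b) (traceGain r v w) (energyGain r v w)
    kemeny-starSpider-change {κ} {κ′} kem kem′ = begin
      volumeOf a b * (volumeOf a b + 2ℚ) * (κ′ - κ)
        ≡⟨ cong (λ D → D * (D + 2ℚ) * (κ′ - κ)) volume-starSpider ⟨
      volume A * (volume A + 2ℚ) * (κ′ - κ)
        ≡⟨ kemeny-change isGreen₀ v≢w vw∉A r w-inv kem kem′ trace-gain energy-gain ⟩
      change (volume A) (energy A green) (traceGain r v w) (energyGain r v w)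
        ≡⟨ cong₂ (λ D q → change D q (traceGain r v w) (energyGain r v w)) volume-starSpider energy-starSpider ⟩
      change (volumeOf a b) (energyOf a b) (traceGain r v w) (energyGain r v w) ∎

  scale>0 : 0ℚ ℚ.< volumeOf a b * (volumeOf a b + 2ℚ)
  scale>0 = 0<* D>0 (ℚₚ.+-mono-< D>0 (ℚₚ.positive⁻¹ 2ℚ))
    where
    D>0 : 0ℚ ℚ.< volumeOf a b
    D>0 = ℚₚ.+-mono-< (0<* (ℚₚ.positive⁻¹ (ι 2)) (ι>0 1≤b1)) (0<* (ℚₚ.positive⁻¹ (ι 4)) (ι>0 1≤b2))

  κ-increases : ∀ {v w} r → r * (1ℚ + (height v + height w)) ≡ 1ℚ → greenV v w ≡ 0ℚ → gramV v w ≡ 0ℚ →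
    ∀ m n → SignedCoefficients 1ℚ (traceGain r v w) (energyGain r v w) (ι m) (ι n) → m ℕ.≤ b1 → n ℕ.≤ b2 →
    index v ≢ index w → A (index v) (index w) ≡ false → IsBraess A (index v) (index w)
  κ-increases {v} {w} r r-inv green≡0 gram≡0 m n signs m≤b1 n≤b2 v≢w vw∉A =
    v≢w , vw∉A , _ , _ , kem , kem′ , κ<κ′
    where
    kem  = Kemeny.kemeny-exists isGreen₀ .proj₂
    kem′ = Kemeny.kemeny-exists (isGreen v≢w vw∉A green≡0 gram≡0 r r-inv) .proj₂
    instance _ = ℚ.nonNegative (ℚₚ.<⇒≤ scale>0)
    κ<κ′ = 0<y-x⇒x<y (ℚₚ.*-cancelˡ-<-nonNeg (volumeOf a b * (volumeOf a b + 2ℚ))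
      (subst₂ ℚ._<_ (sym (ℚₚ.*-zeroʳ (volumeOf a b * (volumeOf a b + 2ℚ)))) (trans (ℚₚ.*-identityˡ _) (sym (kemeny-starSpider-change v≢w vw∉A green≡0 gram≡0 r r-inv kem kem′)))
        (change-sign 1ℚ (traceGain r v w) (energyGain r v w) m n signs m≤b1 n≤b2)))

  -- The two values of κ come from the assumed Braess property. As `kemeny-starSpider-change` holds
  -- for any such values, the change would be positive together with its negative.
  κ-decreases : ∀ {v w} r → r * (1ℚ + (height v + height w)) ≡ 1ℚ → greenV v w ≡ 0ℚ → gramV v w ≡ 0ℚ →
    ∀ m n → SignedCoefficients (- 1ℚ) (traceGain r v w) (energyGain r v w) (ι m) (ι n) → m ℕ.≤ b1 → n ℕ.≤ b2 →
    ¬ IsBraess A (index v) (index w)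
  κ-decreases {v} {w} r r-inv green≡0 gram≡0 m n signs m≤b1 n≤b2 (v≢w , vw∉A , κ , κ′ , kem , kem′ , κ<κ′) =
    ℚₚ.<-irrefl (sym (cancel X)) (ℚₚ.+-mono-< up down)
    where
    cancel : ∀ x → x + (- 1ℚ) * x ≡ 0ℚ
    cancel = solve-∀ ringℚ
    X = change (volumeOf a b) (energyOf a b) (traceGain r v w) (energyGain r v w)
    up : 0ℚ ℚ.< X
    up = subst (0ℚ ℚ.<_) (kemeny-starSpider-change v≢w vw∉A green≡0 gram≡0 r r-inv kem kem′) (0<* scale>0 (x<y⇒0<y-x κ<κ′))
    down : 0ℚ ℚ.< (- 1ℚ) * X
    down = change-sign (- 1ℚ) (traceGain r v w) (energyGain r v w) m n signs m≤b1 n≤b2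

  leaf-leaf-isBraess : ∀ {i j} → i ≢ j → IsBraess A (index (leaf i)) (index (leaf j))
  -- 1/3 is the inverse of 1 + resistance, that is, of the length of the cycle closed by the new
  -- edge. Two distinct leaves force b1 ≥ 2, hence the base point (2 , 1).
  leaf-leaf-isBraess {i} {j} i≢j = κ-increases {leaf i} {leaf j} (ℤ.+ 1 / 3) refl
    (δ-≢ (≢-sym i≢j)) (cong (1ℚ *_) (δ-≢ (≢-sym i≢j))) 2 1 _ (≢⇒2≤ i≢j) 1≤b2
    (λ eq → case index-injective {leaf i} {leaf j} eq of λ { refl → i≢j refl }) (starSpider-index (leaf i) (leaf j))

  adjacent-¬Braess : ∀ v w → edgeᵇ v w ∨ edgeᵇ w v ≡ true → ¬ IsBraess A (index v) (index w)
  adjacent-¬Braess v w e (_ , vw∉A , _) = case trans (sym vw∉A) (trans (starSpider-index v w) e) of λ ()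

  ≮-leaf : ∀ {k} v {j} → label v ≡ suc (b1 ℕ.+ k) → ¬ (index v Fin.< index (leaf j))
  ≮-leaf {k} v {j} label≡ lt = ℕₚ.<⇒≱ (Finₚ.toℕ<n j) (ℕₚ.≤-trans (ℕₚ.m≤m+n b1 k) (ℕₚ.<⇒≤ (ℕ.s≤s⁻¹
    (subst₂ ℕ._<_ (trans (toℕ-index v) label≡) (toℕ-index (leaf j)) lt))))

  -- The centre has label 0, so it cannot be the larger vertex and those cases are absent. Two
  -- different legs force b2 ≥ 2, which gives the base point (1 , 2); the fractions are again
  -- inverse cycle lengths. Where the trace gain is 0 the change is linear: -(46/3) b1 - (44/3) b2
  -- for leaf and middle, -16 b1 - 16 b2 for leaf and end, and -38 b1 - 60 b2 for two ends.
  braess⇒leaf-leaf : ∀ v w → index v Fin.< index w → IsBraess A (index v) (index w) → ∃₂ λ i j → v ≡ leaf i × w ≡ leaf j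
  braess⇒leaf-leaf centre   (leaf j) _ br = contradiction br (adjacent-¬Braess centre (leaf j) refl)
  braess⇒leaf-leaf centre   (mid j)  _ br = contradiction br (adjacent-¬Braess centre (mid j) refl)
  braess⇒leaf-leaf centre   (end j)  _ br =
    contradiction br (κ-decreases {centre} {end j} (ℤ.+ 1 / 3) refl refl refl 1 1 _ 1≤b1 1≤b2)
  braess⇒leaf-leaf (leaf i) (leaf j) _ br = i , j , refl , refl
  braess⇒leaf-leaf (leaf i) (mid j)  _ br =
    contradiction br (κ-decreases {leaf i} {mid j} (ℤ.+ 1 / 3) refl refl refl 1 1 _ 1≤b1 1≤b2)
  braess⇒leaf-leaf (leaf i) (end j)  _ br =
    contradiction br (κ-decreases {leaf i} {end j} (ℤ.+ 1 / 4) refl refl refl 1 1 _ 1≤b1 1≤b2)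
  braess⇒leaf-leaf (mid i)  (leaf j) v<w _ = contradiction v<w (≮-leaf (mid i) refl)
  braess⇒leaf-leaf (mid i)  (mid j)  _ br with i Fin.≟ j
  ... | yes refl = contradiction refl (proj₁ br)
  ... | no i≢j   = contradiction br (κ-decreases {mid i} {mid j} (ℤ.+ 1 / 3) refl (δ-≢ (≢-sym i≢j))
                     (cong (λ t → 2ℚ * t + 1ℚ * t) (δ-≢ (≢-sym i≢j))) 1 2 _ 1≤b1 (≢⇒2≤ i≢j))
  braess⇒leaf-leaf (mid i)  (end j)  _ br with j Fin.≟ i
  ... | yes refl = contradiction br (adjacent-¬Braess (mid i) (end i) (trans (∨-identityʳ _) (dec-true (i Fin.≟ i) refl)))
  ... | no j≢i   = contradiction br (κ-decreases {mid i} {end j} (ℤ.+ 1 / 4) refl (δ-≢ j≢i)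
                     (cong (λ t → 2ℚ * t + 1ℚ * (2ℚ * t)) (δ-≢ j≢i)) 1 2 _ 1≤b1 (≢⇒2≤ j≢i))
  braess⇒leaf-leaf (end i)  (leaf j) v<w _ = contradiction v<w (≮-leaf (end i) refl)
  braess⇒leaf-leaf (end i)  (mid j)  _ br with i Fin.≟ j
  ... | yes refl = contradiction br (adjacent-¬Braess (end i) (mid i) (dec-true (i Fin.≟ i) refl))
  ... | no i≢j   = contradiction br (κ-decreases {end i} {mid j} (ℤ.+ 1 / 4) refl (δ-≢ (≢-sym i≢j))
                     (cong (λ t → 2ℚ * t + 2ℚ * (1ℚ * t)) (δ-≢ (≢-sym i≢j))) 1 2 _ 1≤b1 (≢⇒2≤ i≢j))
  braess⇒leaf-leaf (end i)  (end j)  _ br with i Fin.≟ j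
  ... | yes refl = contradiction refl (proj₁ br)
  ... | no i≢j   = contradiction br (κ-decreases {end i} {end j} (ℤ.+ 1 / 5) refl (cong (2ℚ *_) (δ-≢ (≢-sym i≢j)))
                     (cong (λ t → 2ℚ * t + 2ℚ * (1ℚ * (2ℚ * t))) (δ-≢ (≢-sym i≢j))) 1 2 _ 1≤b1 (≢⇒2≤ i≢j))

  leafPair : Fin b1 × Fin b1 → Fin (order b1 b2) × Fin (order b1 b2)
  leafPair = map× (index ∘ leaf) (index ∘ leaf)

  leaf-< : ∀ {i j} → i Fin.< j → index (leaf i) Fin.< index (leaf j)
  leaf-< {i} {j} i<j = subst₂ ℕ._<_ (sym (toℕ-index (leaf i))) (sym (toℕ-index (leaf j))) (ℕ.s≤s i<j)

  leaf-<⁻ : ∀ {i j} → index (leaf i) Fin.< index (leaf j) → i Fin.< j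
  leaf-<⁻ {i} {j} lt = ℕ.s≤s⁻¹ (subst₂ ℕ._<_ (toℕ-index (leaf i)) (toℕ-index (leaf j)) lt)

  leafPair-injective : ∀ {p q} → leafPair p ≡ leafPair q → p ≡ q
  leafPair-injective {i , j} {k , l} eq
    with refl ← index-injective {leaf i} {leaf k} (cong proj₁ eq)
       | refl ← index-injective {leaf j} {leaf l} (cong proj₂ eq) = refl

  hasBraessNumber : HasBraessNumber A (b1 C 2)
  hasBraessNumber = map leafPair (increasingPairs b1)
    , Uniqueₚ.map⁺ leafPair-injective (increasingPairs-unique b1)
    , trans (length-map leafPair (increasingPairs b1)) (length-increasingPairs b1)
    , λ u v → mk⇔ sound (complete u v)
    where
    sound : ∀ {u v} → (u , v) ∈ map leafPair (increasingPairs b1) → u Fin.< v × IsBraess A u v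
    sound uv∈ with (i , j) , ij∈ , refl ← ∈-map⁻ leafPair uv∈ =
      leaf-< i<j , leaf-leaf-isBraess (Finₚ.<⇒≢ i<j)
      where i<j = ∈-increasingPairs⁻ ij∈
    complete : ∀ u v → u Fin.< v × IsBraess A u v → (u , v) ∈ map leafPair (increasingPairs b1)
    complete = onIndices (λ u → ∀ v → u Fin.< v × IsBraess A u v → (u , v) ∈ map leafPair (increasingPairs b1))
      λ x → onIndices (λ v → index x Fin.< v × IsBraess A (index x) v → (index x , v) ∈ map leafPair (increasingPairs b1))
      λ y (x<y , br) → case braess⇒leaf-leaf x y x<y br of λ { (i , j , refl , refl) →
        ∈-map⁺ leafPair (∈-increasingPairs⁺ (leaf-<⁻ {i} {j} x<y)) }

theorem4p10 : (b1 b2 : ℕ) → 1 ≤ b1 → 1 ≤ b2 →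
    HasBraessNumber (starSpider b1 b2) (b1 C 2)
theorem4p10 b1 b2 1≤b1 1≤b2 = Braess.hasBraessNumber b1 b2 1≤b1 1≤b2
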